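{- Let $\theta$ be an automorphism or an anti-automorphism of $A^*$. Given a regular code $X\subseteq A^*$, each of the following properties holds: (i) The three following conditions are equivalent: - $X$ is maximal as a $\underline{\theta}$-independent code; - $X$ is complete; - $\mu(X)=1$ holds. (ii) One can decide whether $X$ is maximal in the family of $\underline{\theta}$-independent codes. (iii) If $X$ is $\underline{\theta}$-independent, then it can be embedded into a maximal $\underline{\theta}$-independent code.
   Context: $A$ is a finite alphabet with $|A|\ge 2$; $A^*$ is the free monoid over $A$ and $|w|$ is the length of $w$. An anti-automorphism of $A^*$ is a bijection $\theta:A^*\to A^*$ with $\theta(uv)=\theta(v)\theta(u)$ for all $u,v\in A^*$; an automorphism is a monoid automorphism of $A^*$. $\underline{\theta}=\{(w,\theta(w)):w\in A^*,\ \theta(w)\ne w\}$. For a relation $\tau\subseteq A^*\times A^*$, $\tau(X)=\{y:\exists x\in X,\ (x,y)\in\tau\}$, and $X$ is $\tau$-independent if $\tau(X)\cap X=\emptyset$. A subset of $A^*$ is regular if it is recognized by a finite automaton; in decidability statements a regular set is given by a finite automaton. A set $X\subseteq A^*$ is a code if for all words $x_1,\dots,x_n,y_1,\dots,y_p\in X$, $x_1\cdots x_n=y_1\cdots y_p$ implies $n=p$ and $x_i=y_i$ for every $i$. $X$ is complete if every word of $A^*$ is a factor (contiguous subword) of some word in $X^*$, the submonoid generated by $X$. $\mu(X)=\sum_{w\in X}|A|^{ -|w|}$ is the uniform Bernoulli measure. A code $X$ is maximal in the family of $\tau$-independent codes (maximal as a $\tau$-independent code, or a maximal $\tau$-independent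 code) if it belongs to that family and $X\subseteq Y$, with $Y$ in the family, implies $Y=X$.
   Formalization: In (i), the implication from "X is complete" (or μ(X)=1) to "X is maximal as a θ-independent code" is stated for θ-independent X only; without this it fails, e.g. X=A={a,b} with θ swapping a and b. -}

module Defs where

open import Algebra.Morphism.Structures using (module MonoidMorphisms)
open import Data.Fin.Base using (Fin)
open import Data.Fin.Subset using (Subset; _∈_)
open import Data.Integer.Base using (1ℤ)
open import Data.List.Base
  using (List; []; _∷_; _++_; concat; foldr; length; map; ++-[]-rawMonoid)
open import Data.List.Relation.Unary.All using (All)
open import Data.List.Relation.Unary.Unique.Propositional using (Unique)
open import Data.Nat.Base as ℕ using (ℕ; NonTrivial; nonTrivial⇒nonZero)
open import Data.Nat.Properties using (m^n≢0)
open import Data.Product.Base using (_×_; ∃; ∃₂)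
open import Data.Rational.Base using (ℚ; 0ℚ; _+_; _≤_; _<_; _/_)
open import Function.Definitions using (Bijective)
open import Level using (0ℓ)
open import Relation.Binary.Core using (Rel)
open import Relation.Binary.PropositionalEquality.Core using (_≡_; _≢_)
open import Relation.Unary using (Pred; Empty; _∩_; _⊆_; _≐_)

Word : ℕ → Set
Word k = List (Fin k)

Language : ℕ → Set₁
Language k = Pred (Word k) 0ℓ

-- Finite automata may be nondeterministic.
record Automaton (k : ℕ) : Set where
  field
    size    : ℕ
    initial : Subset size
    final   : Subset size
    next    : Fin size → Fin k → Subset size

module _ {k : ℕ} where

  AcceptedFrom : (M : Automaton k) → Fin (Automaton.size M) → Language k
  AcceptedFrom M q []      = q ∈ Automaton.final M
  AcceptedFrom M q (a ∷ w) =
    ∃ λ q′ → q′ ∈ Automaton.next M q a × AcceptedFrom M q′ w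

  Accepted : Automaton k → Language k
  Accepted M w = ∃ λ q → q ∈ Automaton.initial M × AcceptedFrom M q w

  IsAutomorphism : (Word k → Word k) → Set
  IsAutomorphism = IsMonoidIsomorphism
    where open MonoidMorphisms (++-[]-rawMonoid (Fin k)) (++-[]-rawMonoid (Fin k))

  IsAntiAutomorphism : (Word k → Word k) → Set
  IsAntiAutomorphism θ =
    Bijective _≡_ _≡_ θ × (∀ u v → θ (u ++ v) ≡ θ v ++ θ u)

  -- The relation written as θ with an underline.
  graphOffFixedPoints : (Word k → Word k) → Rel (Word k) 0ℓ
  graphOffFixedPoints θ u v = v ≡ θ u × θ u ≢ u

  Image : Rel (Word k) 0ℓ → Language k → Language k
  Image τ X y = ∃ λ x → X x × τ x y

  Independent : Rel (Word k) 0ℓ → Language k → Set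
  Independent τ X = Empty (Image τ X ∩ X)

  IsCode : Language k → Set
  IsCode X = ∀ (xs ys : List (Word k)) → All X xs → All X ys →
             concat xs ≡ concat ys → xs ≡ ys

  Star : Language k → Language k
  Star X w = ∃ λ (xs : List (Word k)) → All X xs × concat xs ≡ w

  _IsFactorOf_ : Word k → Word k → Set
  w IsFactorOf y = ∃₂ λ u v → y ≡ u ++ w ++ v

  Complete : Language k → Set
  Complete X = ∀ w → ∃ λ y → Star X y × w IsFactorOf y

  IndependentCode : Rel (Word k) 0ℓ → Pred (Language k) 0ℓ
  IndependentCode τ X = IsCode X × Independent τ X

  MaximalIn : Pred (Language k) 0ℓ → Language k → Set₁
  MaximalIn 𝓕 X = 𝓕 X × (∀ (Y : Language k) → 𝓕 Y → X ⊆ Y → Y ≐ X)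

module _ {k : ℕ} .{{_ : NonTrivial k}} where

  weight : Word k → ℚ
  weight w = _/_ 1ℤ (k ℕ.^ length w) {{m^n≢0 k (length w) {{nonTrivial⇒nonZero k}}}}

  finiteSum : List (Word k) → ℚ
  finiteSum ws = foldr _+_ 0ℚ (map weight ws)

  FiniteSubset : Language k → List (Word k) → Set
  FiniteSubset X ws = Unique ws × All X ws

  -- "μ(X) = s": a sum of nonnegative terms over an arbitrary index set is the
  -- least upper bound of its finite partial sums.  The value s is rational, so
  -- no real number has to be constructed; the second clause is the (positive)
  -- form of "no r < s is an upper bound".
  HasMeasure : Language k → ℚ → Set
  HasMeasure X s =
    (∀ ws → FiniteSubset X ws → finiteSum ws ≤ s) ×
    (∀ r → r < s → ∃ λ ws → FiniteSubset X ws × r < finiteSum ws)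

{-# OPTIONS --safe #-}
module Submission where

-- Kraft's inequality bounds every finite part of a code by 1: the powers of its
-- measure grow at most linearly.  If a regular code X is complete, every word w
-- satisfies u w v ∈ X* for one of finitely many contexts (u , v), and since the
-- set of all words has infinite measure so does X*, which forces μ(X) = 1.  Such
-- an X is maximal, since one more word would violate Kraft's inequality.
--
-- If X is not complete, some w is not a factor of X*.  Pad w to an overlap-free
-- word y containing w, θ w and θ⁻¹ w, with θ y ≢ y unless θ is the identity,
-- and add to X the irreducible words that start and end with y.  The result Y is
-- a code; it is θ-independent because θ sends no new word to X or to a new word,
-- and no word of X to a new word; and it is maximal because y x y factors over Y
-- for every x.  Hence maximality is equivalent to independence together with
-- completeness, and both are decidable by reachability in finite graphs.

open import Algebra.Bundles using (module CommutativeRing)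
open import Algebra.Morphism.Structures using (module MonoidMorphisms)
open import Data.Bool.Base using (Bool; true; false)
import Data.Bool.Properties as Bool
open import Data.Empty using (⊥; ⊥-elim)
open import Data.Fin.Base as Fin using (Fin)
import Data.Fin.Properties as Fin
open import Data.Fin.Subset as Subset using (Subset; inside; outside)
open import Data.Fin.Subset.Properties using (_∈?_; anySubset?)
open import Data.Integer.Base as ℤ using (+_; -[1+_]; 1ℤ)
import Data.Integer.Properties as ℤ
open import Data.List.Base
open import Data.List.Membership.Propositional using (_∈_; lose)
open import Data.List.Membership.Propositional.Properties
open import Data.List.Properties
open import Data.List.Relation.Unary.All as All using (All; []; _∷_)
import Data.List.Relation.Unary.All.Properties as All
open import Data.List.Relation.Unary.AllPairs using ([]; _∷_)
open import Data.List.Relation.Unary.Any as Any using (here; there)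
open import Data.List.Relation.Unary.Unique.Propositional using (Unique)
import Data.List.Relation.Unary.Unique.Propositional.Properties as Unique
open import Data.Nat.Base as ℕ using (ℕ; zero; suc; NonTrivial; nonTrivial⇒nonZero)
open import Data.Nat.Induction using (<-wellFounded)
import Data.Nat.Properties as ℕ
import Data.Nat.Solver
open import Data.Product.Base hiding (map)
import Data.Product.Properties as Product
open import Data.Rational.Base as ℚ using (ℚ; 0ℚ; 1ℚ; mkℚ)
import Data.Rational.Properties as ℚ
open import Data.Rational.Solver using (module +-*-Solver)
import Data.Rational.Unnormalised.Base as ℚᵘ
import Data.Rational.Unnormalised.Properties as ℚᵘ
open import Data.Sum.Base using (_⊎_; inj₁; inj₂; [_,_]′)
import Data.Vec.Base as Vec
import Data.Vec.Properties as Vec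
open import Defs
open import Function.Base using (_∘_; id; case_of_)
open import Function.Bundles using (_⇔_; mk⇔)
open import Induction.WellFounded using (Acc; acc)
open import Relation.Binary.Construct.Closure.ReflexiveTransitive as RT using (ε; _◅_; _◅◅_)
open import Relation.Binary.Definitions using (DecidableEquality) renaming (Decidable to Decidable₂)
open import Relation.Binary.PropositionalEquality
open import Relation.Nullary
open import Relation.Nullary.Decidable using (decidable-stable; dec-true; map′; _×-dec_; _⊎-dec_)
open import Relation.Unary using (Decidable; _⊆_; _∪_; _≐_)

open import Algebra.Properties.Semiring.Exp (CommutativeRing.semiring ℚ.+-*-commutativeRing) using (_^_; ^-homo-*)

-- No limit is ever taken: each estimate concerns a finite part of a code and a rational bound. A
-- linear bound on the powers of a number replaces convergence of a series, and a geometric sum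
-- multiplied by `1 - s` replaces the quotient `1 / (1 - s)`. The infinite measure of the set of all
-- words enters as `n + 1`, the weight of the words of length at most `n`.
--
-- Overlap-freeness of `y` pins down the first `y` in any product over the completed code: it cannot
-- straddle the end of a product over `X` and run into another `y`. Reading a product from `y` to
-- `y` is then unambiguous, and irreducibility of the added words says where each of them stops.
--
-- The argument is constructive. The automaton decides membership in `X`, but splitting of flanked
-- words is never decided, so their factorizations over the completed code exist only under a double
-- negation. It is removed where the goal is decidable or itself a negation.

private
  module ℕS = Data.Nat.Solver.+-*-Solver
  variable
    A B : Set

-- Rational sums and Bernoulli's inequality

fromℕ : ℕ → ℚ
fromℕ n = + n ℚ./ 1

fromℕ-suc : ∀ n → fromℕ (suc n) ≡ 1ℚ ℚ.+ fromℕ n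
fromℕ-suc n = ℚ.toℚᵘ-injective (begin
  ℚ.toℚᵘ (fromℕ (suc n))                    ≈⟨ ℚ.toℚᵘ-fromℚᵘ (ℚᵘ.mkℚᵘ (+ suc n) 0) ⟩
  ℚᵘ.mkℚᵘ (+ suc n) 0
    ≈⟨ ℚᵘ.*≡* (cong (ℤ._* + 1) (cong (λ x → + 1 ℤ.+ x) (sym (ℤ.*-identityʳ (+ n))))) ⟩
  ℚᵘ.1ℚᵘ ℚᵘ.+ ℚᵘ.mkℚᵘ (+ n) 0
    ≈⟨ ℚᵘ.+-congʳ ℚᵘ.1ℚᵘ (ℚᵘ.≃-sym (ℚ.toℚᵘ-fromℚᵘ (ℚᵘ.mkℚᵘ (+ n) 0))) ⟩
  ℚᵘ.1ℚᵘ ℚᵘ.+ ℚ.toℚᵘ (fromℕ n)              ≈⟨ ℚᵘ.≃-sym (ℚ.toℚᵘ-homo-+ 1ℚ (fromℕ n)) ⟩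
  ℚ.toℚᵘ (1ℚ ℚ.+ fromℕ n)                   ∎)
  where open ℚᵘ.≃-Reasoning

archimedean : ∀ q → ∃ λ n → q ℚ.< fromℕ n
archimedean q@(mkℚ n d _) = suc ℤ.∣ n ∣ , ℚ.toℚᵘ-cancel-< (begin-strict
  ℚᵘ.mkℚᵘ n d                       <⟨ ℚᵘ.*<* (less n) ⟩
  ℚᵘ.mkℚᵘ (+ suc ℤ.∣ n ∣) 0         ≃⟨ ℚᵘ.≃-sym (ℚ.toℚᵘ-fromℚᵘ (ℚᵘ.mkℚᵘ (+ suc ℤ.∣ n ∣) 0)) ⟩
  ℚ.toℚᵘ (fromℕ (suc ℤ.∣ n ∣))      ∎)
  where
  open ℚᵘ.≤-Reasoning
  less : ∀ n → n ℤ.* + 1 ℤ.< + suc ℤ.∣ n ∣ ℤ.* + suc d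
  less (+ m) rewrite ℕ.*-identityʳ m | ℤ.+◃n≡+n m = ℤ.+<+ (ℕ.m≤m*n (suc m) (suc d))
  less -[1+ m ] = ℤ.-<+

unit-* : ∀ m n .{{_ : ℕ.NonZero m}} .{{_ : ℕ.NonZero n}} .{{_ : ℕ.NonZero (m ℕ.* n)}} →
         1ℤ ℚ./ (m ℕ.* n) ≡ (1ℤ ℚ./ m) ℚ.* (1ℤ ℚ./ n)
unit-* (suc m) (suc n) = ℚ.toℚᵘ-injective (begin
  ℚ.toℚᵘ (ℚ.fromℚᵘ (p ℚᵘ.* q))                      ≈⟨ ℚ.toℚᵘ-fromℚᵘ (p ℚᵘ.* q) ⟩
  p ℚᵘ.* q
    ≈⟨ ℚᵘ.≃-sym (ℚᵘ.*-cong (ℚ.toℚᵘ-fromℚᵘ p) (ℚ.toℚᵘ-fromℚᵘ q)) ⟩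
  ℚ.toℚᵘ (ℚ.fromℚᵘ p) ℚᵘ.* ℚ.toℚᵘ (ℚ.fromℚᵘ q)      ≈⟨ ℚᵘ.≃-sym (ℚ.toℚᵘ-homo-* (ℚ.fromℚᵘ p) (ℚ.fromℚᵘ q)) ⟩
  ℚ.toℚᵘ (ℚ.fromℚᵘ p ℚ.* ℚ.fromℚᵘ q)                ∎)
  where
  open ℚᵘ.≃-Reasoning
  p = ℚᵘ.mkℚᵘ 1ℤ m
  q = ℚᵘ.mkℚᵘ 1ℤ n

fromℕ-*-unit : ∀ n .{{_ : ℕ.NonZero n}} → fromℕ n ℚ.* (1ℤ ℚ./ n) ≡ 1ℚ
fromℕ-*-unit (suc n) = ℚ.toℚᵘ-injective (begin
  ℚ.toℚᵘ (ℚ.fromℚᵘ p ℚ.* ℚ.fromℚᵘ q)                ≈⟨ ℚ.toℚᵘ-homo-* (ℚ.fromℚᵘ p) (ℚ.fromℚᵘ q) ⟩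
  ℚ.toℚᵘ (ℚ.fromℚᵘ p) ℚᵘ.* ℚ.toℚᵘ (ℚ.fromℚᵘ q)      ≈⟨ ℚᵘ.*-cong (ℚ.toℚᵘ-fromℚᵘ p) (ℚ.toℚᵘ-fromℚᵘ q) ⟩
  p ℚᵘ.* q                                          ≈⟨ ℚᵘ.*≡* (cong +_ arith) ⟩
  ℚᵘ.1ℚᵘ                                            ∎)
  where
  open ℚᵘ.≃-Reasoning
  p = ℚᵘ.mkℚᵘ (+ suc n) 0
  q = ℚᵘ.mkℚᵘ 1ℤ n
  arith : suc ((n ℕ.* 1) ℕ.* 1) ≡ suc ((n ℕ.+ 0) ℕ.+ 0)
  arith = cong suc (trans (trans (ℕ.*-identityʳ (n ℕ.* 1)) (ℕ.*-identityʳ n))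
                          (sym (trans (ℕ.+-identityʳ (n ℕ.+ 0)) (ℕ.+-identityʳ n))))

fromℕ-+ : ∀ m n → fromℕ (m ℕ.+ n) ≡ fromℕ m ℚ.+ fromℕ n
fromℕ-+ zero    n = sym (ℚ.+-identityˡ (fromℕ n))
fromℕ-+ (suc m) n = begin
  fromℕ (suc (m ℕ.+ n))             ≡⟨ fromℕ-suc (m ℕ.+ n) ⟩
  1ℚ ℚ.+ fromℕ (m ℕ.+ n)            ≡⟨ cong (1ℚ ℚ.+_) (fromℕ-+ m n) ⟩
  1ℚ ℚ.+ (fromℕ m ℚ.+ fromℕ n)      ≡⟨ ℚ.+-assoc 1ℚ (fromℕ m) (fromℕ n) ⟨
  1ℚ ℚ.+ fromℕ m ℚ.+ fromℕ n        ≡⟨ cong (ℚ._+ fromℕ n) (fromℕ-suc m) ⟨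
  fromℕ (suc m) ℚ.+ fromℕ n         ∎
  where open ≡-Reasoning

fromℕ-* : ∀ m n → fromℕ (m ℕ.* n) ≡ fromℕ m ℚ.* fromℕ n
fromℕ-* zero    n = sym (ℚ.*-zeroˡ (fromℕ n))
fromℕ-* (suc m) n = begin
  fromℕ (n ℕ.+ m ℕ.* n)             ≡⟨ fromℕ-+ n (m ℕ.* n) ⟩
  fromℕ n ℚ.+ fromℕ (m ℕ.* n)       ≡⟨ cong (fromℕ n ℚ.+_) (fromℕ-* m n) ⟩
  fromℕ n ℚ.+ fromℕ m ℚ.* fromℕ n
    ≡⟨ solve 2 (λ a b → a :+ b :* a := (con 1ℚ :+ b) :* a) refl (fromℕ n) (fromℕ m) ⟩
  (1ℚ ℚ.+ fromℕ m) ℚ.* fromℕ n      ≡⟨ cong (ℚ._* fromℕ n) (fromℕ-suc m) ⟨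
  fromℕ (suc m) ℚ.* fromℕ n         ∎
  where
    open ≡-Reasoning
    open +-*-Solver

0≤fromℕ : ∀ n → 0ℚ ℚ.≤ fromℕ n
0≤fromℕ n = ℚ.nonNegative⁻¹ (fromℕ n) {{ℚ.normalize-nonNeg n 1}}

fromℕ-mono-≤ : ∀ {m n} → m ℕ.≤ n → fromℕ m ℚ.≤ fromℕ n
fromℕ-mono-≤ {m} {n} m≤n = begin
  fromℕ m                         ≡⟨ ℚ.+-identityʳ (fromℕ m) ⟨
  fromℕ m ℚ.+ 0ℚ                  ≤⟨ ℚ.+-monoʳ-≤ (fromℕ m) (0≤fromℕ (n ℕ.∸ m)) ⟩
  fromℕ m ℚ.+ fromℕ (n ℕ.∸ m)     ≡⟨ fromℕ-+ m (n ℕ.∸ m) ⟨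
  fromℕ (m ℕ.+ (n ℕ.∸ m))         ≡⟨ cong fromℕ (ℕ.m+[n∸m]≡n m≤n) ⟩
  fromℕ n                         ∎
  where open ℚ.≤-Reasoning

archimedean-* : ∀ {e} q → 0ℚ ℚ.< e → ∃ λ n → q ℚ.< fromℕ n ℚ.* e
archimedean-* {e} q 0<e = proj₁ large , (begin-strict
  q                                   ≡⟨ ℚ.*-identityʳ q ⟨
  q ℚ.* 1ℚ                            ≡⟨ cong (q ℚ.*_) (ℚ.*-inverseˡ e) ⟨
  q ℚ.* (ℚ.1/ e ℚ.* e)                ≡⟨ ℚ.*-assoc q (ℚ.1/ e) e ⟨
  q ℚ.* ℚ.1/ e ℚ.* e                  <⟨ ℚ.*-monoˡ-<-pos e (proj₂ large) ⟩
  fromℕ (proj₁ large) ℚ.* e           ∎)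
  where
  open ℚ.≤-Reasoning
  instance
    e>0 : ℚ.Positive e
    e>0 = ℚ.positive 0<e
    e≢0 : ℚ.NonZero e
    e≢0 = ℚ.pos⇒nonZero e
  large = archimedean (q ℚ.* ℚ.1/ e)

+-nonneg : ∀ {p q} → 0ℚ ℚ.≤ p → 0ℚ ℚ.≤ q → 0ℚ ℚ.≤ p ℚ.+ q
+-nonneg = ℚ.+-mono-≤

*-mono-≤ : ∀ {p q r s} → 0ℚ ℚ.≤ p → 0ℚ ℚ.≤ s → p ℚ.≤ q → r ℚ.≤ s → p ℚ.* r ℚ.≤ q ℚ.* s
*-mono-≤ {p} {q} {r} {s} 0≤p 0≤s p≤q r≤s = ℚ.≤-trans
  (ℚ.*-monoˡ-≤-nonNeg p {{ℚ.nonNegative 0≤p}} r≤s)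
  (ℚ.*-monoʳ-≤-nonNeg s {{ℚ.nonNegative 0≤s}} p≤q)

*-nonneg : ∀ {p q} → 0ℚ ℚ.≤ p → 0ℚ ℚ.≤ q → 0ℚ ℚ.≤ p ℚ.* q
*-nonneg 0≤p 0≤q = *-mono-≤ ℚ.≤-refl 0≤q 0≤p 0≤q

total : (A → ℚ) → List A → ℚ
total f xs = foldr ℚ._+_ 0ℚ (map f xs)

module _ (f : A → ℚ) where

  total-++ : ∀ xs ys → total f (xs ++ ys) ≡ total f xs ℚ.+ total f ys
  total-++ []       ys = sym (ℚ.+-identityˡ _)
  total-++ (x ∷ xs) ys = trans (cong (f x ℚ.+_) (total-++ xs ys)) (sym (ℚ.+-assoc (f x) _ _))

  total-middle : ∀ x xs ys → total f (xs ++ x ∷ ys) ≡ f x ℚ.+ total f (xs ++ ys)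
  total-middle x xs ys = begin
    total f (xs ++ x ∷ ys)                     ≡⟨ total-++ xs (x ∷ ys) ⟩
    total f xs ℚ.+ (f x ℚ.+ total f ys)
      ≡⟨ solve 3 (λ a b c → a :+ (b :+ c) := b :+ (a :+ c)) refl (total f xs) (f x) (total f ys) ⟩
    f x ℚ.+ (total f xs ℚ.+ total f ys)        ≡⟨ cong (f x ℚ.+_) (total-++ xs ys) ⟨
    f x ℚ.+ total f (xs ++ ys)                 ∎
    where
      open ≡-Reasoning
      open +-*-Solver

  total-map : ∀ (g : B → A) xs → total f (map g xs) ≡ total (f ∘ g) xs
  total-map g xs = cong (foldr ℚ._+_ 0ℚ) (sym (map-∘ xs))

  total-const : ∀ q → (∀ x → f x ≡ q) → ∀ xs → total f xs ≡ fromℕ (length xs) ℚ.* q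
  total-const q f≡q []       = sym (ℚ.*-zeroˡ q)
  total-const q f≡q (x ∷ xs) = begin
    f x ℚ.+ total f xs                              ≡⟨ cong₂ ℚ._+_ (f≡q x) (total-const q f≡q xs) ⟩
    q ℚ.+ fromℕ (length xs) ℚ.* q
      ≡⟨ solve 2 (λ a b → a :+ b :* a := (con 1ℚ :+ b) :* a) refl q (fromℕ (length xs)) ⟩
    (1ℚ ℚ.+ fromℕ (length xs)) ℚ.* q                ≡⟨ cong (ℚ._* q) (fromℕ-suc (length xs)) ⟨
    fromℕ (suc (length xs)) ℚ.* q                   ∎
    where
      open ≡-Reasoning
      open +-*-Solver

  total-cong : ∀ {g} → (∀ x → f x ≡ g x) → ∀ xs → total f xs ≡ total g xs
  total-cong f≗g xs = cong (foldr ℚ._+_ 0ℚ) (map-cong f≗g xs)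

  total-scale : ∀ q xs → total (λ x → q ℚ.* f x) xs ≡ q ℚ.* total f xs
  total-scale q []       = sym (ℚ.*-zeroʳ q)
  total-scale q (x ∷ xs) = trans (cong (q ℚ.* f x ℚ.+_) (total-scale q xs)) (sym (ℚ.*-distribˡ-+ q _ _))

  module _ (f≥0 : ∀ x → 0ℚ ℚ.≤ f x) where

    total-nonneg : ∀ xs → 0ℚ ℚ.≤ total f xs
    total-nonneg []       = ℚ.≤-refl
    total-nonneg (x ∷ xs) = +-nonneg (f≥0 x) (total-nonneg xs)

    total-mono-⊆ : ∀ {xs ys} → Unique xs → (∀ {x} → x ∈ xs → x ∈ ys) → total f xs ℚ.≤ total f ys
    total-mono-⊆ {[]}     {ys} _            _     = total-nonneg ys
    total-mono-⊆ {x ∷ xs}      (x∉xs ∷ xs!) xs⊆ys with ∈-∃++ (xs⊆ys (here refl))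
    ... | ys , zs , refl = ℚ.≤-trans
      (ℚ.+-monoʳ-≤ (f x) (total-mono-⊆ xs! remaining))
      (ℚ.≤-reflexive (sym (total-middle x ys zs)))
      where
      remaining : ∀ {z} → z ∈ xs → z ∈ ys ++ zs
      remaining z∈xs with ∈-++⁻ ys (xs⊆ys (there z∈xs))
      ... | inj₁ z∈ys         = ∈-++⁺ˡ z∈ys
      ... | inj₂ (there z∈zs) = ∈-++⁺ʳ ys z∈zs
      ... | inj₂ (here refl)  = ⊥-elim (All.lookup x∉xs z∈xs refl)

-- Distributivity, for any pairing with multiplicative weight. It serves letters against words,
-- words against tuples of words, and contexts against factorizations.
total-product : ∀ (f : A → ℚ) (g : B → ℚ) {C : Set} (h : C → ℚ) (_⊗_ : A → B → C) →
                (∀ x y → h (x ⊗ y) ≡ f x ℚ.* g y) →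
                ∀ xs ys → total h (cartesianProductWith _⊗_ xs ys) ≡ total f xs ℚ.* total g ys
total-product f g h _⊗_ h≡f*g []       ys = sym (ℚ.*-zeroˡ (total g ys))
total-product f g h _⊗_ h≡f*g (x ∷ xs) ys = begin
  total h (map (x ⊗_) ys ++ cartesianProductWith _⊗_ xs ys)
    ≡⟨ total-++ h (map (x ⊗_) ys) _ ⟩
  total h (map (x ⊗_) ys) ℚ.+ total h (cartesianProductWith _⊗_ xs ys)
    ≡⟨ cong₂ ℚ._+_ (trans (total-map h (x ⊗_) ys) (total-cong _ (h≡f*g x) ys)) (total-product f g h _⊗_ h≡f*g xs ys) ⟩
  total (λ y → f x ℚ.* g y) ys ℚ.+ total f xs ℚ.* total g ys
    ≡⟨ cong (ℚ._+ total f xs ℚ.* total g ys) (total-scale g (f x) ys) ⟩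
  f x ℚ.* total g ys ℚ.+ total f xs ℚ.* total g ys
    ≡⟨ ℚ.*-distribʳ-+ (total g ys) (f x) (total f xs) ⟨
  (f x ℚ.+ total f xs) ℚ.* total g ys ∎
  where open ≡-Reasoning


-- Injectivity is asked only between members of the list, because `concat` is injective only on
-- lists of words from a code.
unique-map : ∀ (f : A → B) {xs} → (∀ {x y} → x ∈ xs → y ∈ xs → f x ≡ f y → x ≡ y) →
             Unique xs → Unique (map f xs)
unique-map f {[]}     _   []           = []
unique-map f {x ∷ xs} inj (x∉xs ∷ xs!) =
  All.tabulate fresh ∷ unique-map f (λ y∈ z∈ → inj (there y∈) (there z∈)) xs!
  where
  fresh : ∀ {z} → z ∈ map f xs → f x ≢ z
  fresh z∈ fx≡z with ∈-map⁻ f z∈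
  ... | y , y∈xs , refl = All.lookup x∉xs y∈xs (inj (here refl) (there y∈xs) fx≡z)

-- Uniform weights of words and their enumeration by length

module _ {k : ℕ} .{{_ : NonTrivial k}} where

  private instance
    k≢0 : ℕ.NonZero k
    k≢0 = nonTrivial⇒nonZero k

  κ : ℚ
  κ = 1ℤ ℚ./ k

  0<weight : ∀ (w : Word k) → 0ℚ ℚ.< weight w
  0<weight w = ℚ.positive⁻¹ (weight w) {{ℚ.normalize-pos 1 (k ℕ.^ length w) {{ℕ.m^n≢0 k (length w)}}}}

  0≤weight : ∀ (w : Word k) → 0ℚ ℚ.≤ weight w
  0≤weight w = ℚ.<⇒≤ (0<weight w)

  weight-∷ : ∀ a (w : Word k) → weight (a ∷ w) ≡ κ ℚ.* weight w
  weight-∷ a w = unit-* k (k ℕ.^ length w) {{k≢0}} {{ℕ.m^n≢0 k (length w)}} {{ℕ.m^n≢0 k (suc (length w))}}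

  weight-++ : ∀ (u v : Word k) → weight (u ++ v) ≡ weight u ℚ.* weight v
  weight-++ []      v = sym (ℚ.*-identityˡ (weight v))
  weight-++ (a ∷ u) v = begin
    weight (a ∷ u ++ v)                ≡⟨ weight-∷ a (u ++ v) ⟩
    κ ℚ.* weight (u ++ v)              ≡⟨ cong (κ ℚ.*_) (weight-++ u v) ⟩
    κ ℚ.* (weight u ℚ.* weight v)      ≡⟨ ℚ.*-assoc κ _ _ ⟨
    κ ℚ.* weight u ℚ.* weight v        ≡⟨ cong (ℚ._* weight v) (weight-∷ a u) ⟨
    weight (a ∷ u) ℚ.* weight v        ∎
    where open ≡-Reasoning

  words : ℕ → List (Word k)
  words zero    = [] ∷ []
  words (suc n) = cartesianProductWith _∷_ (allFin k) (words n)

  wordsUpTo : ℕ → List (Word k)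
  wordsUpTo zero    = words zero
  wordsUpTo (suc n) = words (suc n) ++ wordsUpTo n

  ∈-words : ∀ (w : Word k) → w ∈ words (length w)
  ∈-words []      = here refl
  ∈-words (a ∷ w) = ∈-cartesianProductWith⁺ _∷_ (∈-allFin a) (∈-words w)

  length-∈-words : ∀ n {w} → w ∈ words n → length w ≡ n
  length-∈-words zero    (here refl) = refl
  length-∈-words (suc n) w∈ with ∈-cartesianProductWith⁻ _∷_ (allFin k) (words n) w∈
  ... | _ , _ , _ , v∈ , refl = cong suc (length-∈-words n v∈)

  ∈-wordsUpTo : ∀ {n} {w : Word k} → length w ℕ.≤ n → w ∈ wordsUpTo n
  ∈-wordsUpTo {zero}  {[]} _    = here refl
  ∈-wordsUpTo {suc n} {w}  ∣w∣≤ with ℕ.m≤n⇒m<n∨m≡n ∣w∣≤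
  ... | inj₁ (ℕ.s≤s ∣w∣≤n) = ∈-++⁺ʳ (words (suc n)) (∈-wordsUpTo ∣w∣≤n)
  ... | inj₂ ∣w∣≡1+n       = ∈-++⁺ˡ (subst (λ m → w ∈ words m) ∣w∣≡1+n (∈-words w))

  length-∈-wordsUpTo : ∀ n {w} → w ∈ wordsUpTo n → length w ℕ.≤ n
  length-∈-wordsUpTo zero    (here refl) = ℕ.z≤n
  length-∈-wordsUpTo (suc n) w∈ with ∈-++⁻ (words (suc n)) w∈
  ... | inj₁ w∈words = ℕ.≤-reflexive (length-∈-words (suc n) w∈words)
  ... | inj₂ w∈rest  = ℕ.m≤n⇒m≤1+n (length-∈-wordsUpTo n w∈rest)

  words-unique : ∀ n → Unique (words n)
  words-unique zero    = [] ∷ []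
  words-unique (suc n) = Unique.cartesianProductWith⁺ _∷_ ∷-injective (Unique.allFin⁺ k) (words-unique n)

  wordsUpTo-unique : ∀ n → Unique (wordsUpTo n)
  wordsUpTo-unique zero    = words-unique zero
  wordsUpTo-unique (suc n) = Unique.++⁺ (words-unique (suc n)) (wordsUpTo-unique n) λ
    { (v∈ , v∈′) → ℕ.<⇒≢ (ℕ.s≤s (length-∈-wordsUpTo n v∈′)) (length-∈-words (suc n) v∈) }

  finiteSum-words : ∀ n → finiteSum (words n) ≡ 1ℚ
  finiteSum-words zero    = refl
  finiteSum-words (suc n) = begin
    total weight (words (suc n))
      ≡⟨ total-product (λ _ → κ) weight weight _∷_ weight-∷ (allFin k) (words n) ⟩
    total (λ _ → κ) (allFin k) ℚ.* total weight (words n)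
      ≡⟨ cong₂ ℚ._*_ (total-const (λ _ → κ) κ (λ _ → refl) (allFin k)) (finiteSum-words n) ⟩
    fromℕ (length (allFin k)) ℚ.* κ ℚ.* 1ℚ
      ≡⟨ ℚ.*-identityʳ _ ⟩
    fromℕ (length (allFin k)) ℚ.* κ
      ≡⟨ cong (λ n → fromℕ n ℚ.* κ) (length-tabulate {n = k} id) ⟩
    fromℕ k ℚ.* κ
      ≡⟨ fromℕ-*-unit k ⟩
    1ℚ ∎
    where open ≡-Reasoning

  finiteSum-wordsUpTo : ∀ n → finiteSum (wordsUpTo n) ≡ fromℕ (suc n)
  finiteSum-wordsUpTo zero    = refl
  finiteSum-wordsUpTo (suc n) = begin
    total weight (words (suc n) ++ wordsUpTo n)       ≡⟨ total-++ weight (words (suc n)) (wordsUpTo n) ⟩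
    total weight (words (suc n)) ℚ.+ total weight (wordsUpTo n)
      ≡⟨ cong₂ ℚ._+_ (finiteSum-words (suc n)) (finiteSum-wordsUpTo n) ⟩
    1ℚ ℚ.+ fromℕ (suc n)                              ≡⟨ fromℕ-suc (suc n) ⟨
    fromℕ (suc (suc n))                               ∎
    where open ≡-Reasoning

bernoulli : ∀ {e} → 0ℚ ℚ.≤ e → ∀ n → 1ℚ ℚ.+ fromℕ n ℚ.* e ℚ.≤ (1ℚ ℚ.+ e) ^ n
bernoulli {e} 0≤e zero    = ℚ.≤-reflexive (trans (cong (1ℚ ℚ.+_) (ℚ.*-zeroˡ e)) (ℚ.+-identityʳ 1ℚ))
bernoulli {e} 0≤e (suc n) = begin
  1ℚ ℚ.+ fromℕ (suc n) ℚ.* e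
    ≡⟨ cong (λ x → 1ℚ ℚ.+ x ℚ.* e) (fromℕ-suc n) ⟩
  1ℚ ℚ.+ (1ℚ ℚ.+ N) ℚ.* e
    ≡⟨ ℚ.+-identityʳ _ ⟨
  1ℚ ℚ.+ (1ℚ ℚ.+ N) ℚ.* e ℚ.+ 0ℚ
    ≤⟨ ℚ.+-monoʳ-≤ (1ℚ ℚ.+ (1ℚ ℚ.+ N) ℚ.* e) (*-nonneg (0≤fromℕ n) (*-nonneg 0≤e 0≤e)) ⟩
  1ℚ ℚ.+ (1ℚ ℚ.+ N) ℚ.* e ℚ.+ N ℚ.* (e ℚ.* e)
    ≡⟨ solve 2 (λ e n → con 1ℚ :+ (con 1ℚ :+ n) :* e :+ n :* (e :* e) := (con 1ℚ :+ e) :* (con 1ℚ :+ n :* e)) refl e N ⟩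
  (1ℚ ℚ.+ e) ℚ.* (1ℚ ℚ.+ N ℚ.* e)
    ≤⟨ *-mono-≤ 0≤1+e (ℚ.≤-trans (+-nonneg 0≤1 (*-nonneg (0≤fromℕ n) 0≤e)) (bernoulli 0≤e n)) ℚ.≤-refl (bernoulli 0≤e n) ⟩
  (1ℚ ℚ.+ e) ℚ.* (1ℚ ℚ.+ e) ^ n ∎
  where
  open ℚ.≤-Reasoning
  open +-*-Solver
  N = fromℕ n
  0≤1 : 0ℚ ℚ.≤ 1ℚ
  0≤1 = 0≤fromℕ 1
  0≤1+e : 0ℚ ℚ.≤ 1ℚ ℚ.+ e
  0≤1+e = +-nonneg 0≤1 0≤e

-- Squaring Bernoulli's inequality makes it quadratic in n.
linearly-bounded-powers : ∀ s c → (∀ n → s ^ n ℚ.≤ fromℕ (suc (n ℕ.* c))) → s ℚ.≤ 1ℚ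
linearly-bounded-powers s c s^n≤ = ℚ.≮⇒≥ λ 1<s → contradict 1<s (archimedean-* (fromℕ d) (0<e² 1<s))
  where
  -- Chosen so that `1 + 2nc ≤ nd` for every `n ≥ 1`; once `n e² > d`, the square of `n e` exceeds
  -- the linear bound at exponent `2n`.
  d = suc (c ℕ.+ c)
  e = s ℚ.- 1ℚ

  0<e : 1ℚ ℚ.< s → 0ℚ ℚ.< e
  0<e 1<s = subst (ℚ._< e) (ℚ.+-inverseʳ 1ℚ) (ℚ.+-monoˡ-< (ℚ.- 1ℚ) 1<s)

  0<e² : 1ℚ ℚ.< s → 0ℚ ℚ.< e ℚ.* e
  0<e² 1<s = subst (ℚ._< e ℚ.* e) (ℚ.*-zeroˡ e)
    (ℚ.*-monoˡ-<-pos e {{ℚ.positive (0<e 1<s)}} (0<e 1<s))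

  contradict : 1ℚ ℚ.< s → ∃ (λ n → fromℕ d ℚ.< fromℕ n ℚ.* (e ℚ.* e)) → ⊥
  contradict 1<s (zero  , d<) = ℚ.<-irrefl refl
    (ℚ.<-≤-trans d< (subst (ℚ._≤ fromℕ d) (sym (ℚ.*-zeroˡ (e ℚ.* e))) (0≤fromℕ d)))
  contradict 1<s (n@(suc m) , d<) = ℚ.<-irrefl refl (begin-strict
    fromℕ n ℚ.* fromℕ d                       <⟨ ℚ.*-monoʳ-<-pos (fromℕ n) {{ℚ.normalize-pos n 1}} d< ⟩
    fromℕ n ℚ.* (fromℕ n ℚ.* (e ℚ.* e))
      ≡⟨ solve 2 (λ n e → n :* (n :* (e :* e)) := (n :* e) :* (n :* e)) refl (fromℕ n) e ⟩
    ne ℚ.* ne                                 ≤⟨ *-mono-≤ 0≤ne (ℚ.≤-trans 0≤ne ne≤) ne≤ ne≤ ⟩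
    s ^ n ℚ.* s ^ n                           ≡⟨ ^-homo-* s n n ⟨
    s ^ (n ℕ.+ n)                             ≤⟨ s^n≤ (n ℕ.+ n) ⟩
    fromℕ (suc ((n ℕ.+ n) ℕ.* c))             ≤⟨ fromℕ-mono-≤ arith ⟩
    fromℕ (n ℕ.* d)                           ≡⟨ fromℕ-* n d ⟩
    fromℕ n ℚ.* fromℕ d                       ∎)
    where
    open ℚ.≤-Reasoning
    open +-*-Solver
    ne = fromℕ n ℚ.* e
    0≤e = ℚ.<⇒≤ (0<e 1<s)
    0≤ne : 0ℚ ℚ.≤ ne
    0≤ne = *-nonneg (0≤fromℕ n) 0≤e
    ne≤ : ne ℚ.≤ s ^ n
    ne≤ = ℚ.≤-trans
      (subst (ℚ._≤ 1ℚ ℚ.+ ne) (ℚ.+-identityˡ ne) (ℚ.+-monoˡ-≤ ne (0≤fromℕ 1)))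
      (subst (λ x → 1ℚ ℚ.+ ne ℚ.≤ x ^ n) (solve 1 (λ s → con 1ℚ :+ (s :- con 1ℚ) := s) refl s) (bernoulli 0≤e n))
    arith : suc ((n ℕ.+ n) ℕ.* c) ℕ.≤ n ℕ.* d
    arith = ℕ.≤-trans (ℕ.+-monoˡ-≤ ((n ℕ.+ n) ℕ.* c) (ℕ.s≤s (ℕ.z≤n {m})))
      (ℕ.≤-reflexive (ℕS.solve 2 (λ n c → n ℕS.:+ (n ℕS.:+ n) ℕS.:* c ℕS.:= n ℕS.:* (ℕS.con 1 ℕS.:+ (c ℕS.:+ c))) refl n c))

-- Kraft's inequality and the measure of a complete code

concat-length-≤ : ∀ {L} (xss : List (List A)) → All (λ xs → length xs ℕ.≤ L) xss →
                  length (concat xss) ℕ.≤ length xss ℕ.* L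
concat-length-≤ []         []           = ℕ.z≤n
concat-length-≤ (xs ∷ xss) (xs≤ ∷ xss≤) = ℕ.≤-trans
  (ℕ.≤-reflexive (length-++ xs)) (ℕ.+-mono-≤ xs≤ (concat-length-≤ xss xss≤))

length-≤-concat : ∀ (xss : List (List A)) → All (_≢ []) xss → length xss ℕ.≤ length (concat xss)
length-≤-concat []               []         = ℕ.z≤n
length-≤-concat ([] ∷ xss)       (≢[] ∷ _)  = ⊥-elim (≢[] refl)
length-≤-concat ((_ ∷ xs) ∷ xss) (_ ∷ xss≢) = ℕ.s≤s (ℕ.≤-trans (length-≤-concat xss xss≢)
  (ℕ.≤-trans (ℕ.m≤n+m _ (length xs)) (ℕ.≤-reflexive (sym (length-++ xs)))))

∈-length-≤-concat : ∀ {xs} (xss : List (List A)) → xs ∈ xss → length xs ℕ.≤ length (concat xss)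
∈-length-≤-concat (xs ∷ xss) (here refl) = ℕ.≤-trans (ℕ.m≤m+n (length xs) _) (ℕ.≤-reflexive (sym (length-++ xs)))
∈-length-≤-concat (ys ∷ xss) (there xs∈) = ℕ.≤-trans (∈-length-≤-concat xss xs∈)
  (ℕ.≤-trans (ℕ.m≤n+m _ (length ys)) (ℕ.≤-reflexive (sym (length-++ ys))))

bounded : ∀ (f : A → ℕ) xs → ∃ λ n → ∀ {x} → x ∈ xs → f x ℕ.≤ n
bounded f []       = 0 , λ ()
bounded f (x ∷ xs) with bounded f xs
... | n , f≤n = f x ℕ.⊔ n , λ { (here refl) → ℕ.m≤m⊔n (f x) n ; (there x∈) → ℕ.≤-trans (f≤n x∈) (ℕ.m≤n⊔m (f x) n) }

powers : List A → ℕ → List (List A)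
powers xs zero    = [] ∷ []
powers xs (suc n) = cartesianProductWith _∷_ xs (powers xs n)

powersUpTo : List A → ℕ → List (List A)
powersUpTo xs zero    = powers xs zero
powersUpTo xs (suc n) = powers xs (suc n) ++ powersUpTo xs n

powers-unique : ∀ {xs : List A} → Unique xs → ∀ n → Unique (powers xs n)
powers-unique xs! zero    = [] ∷ []
powers-unique xs! (suc n) = Unique.cartesianProductWith⁺ _∷_ ∷-injective xs! (powers-unique xs! n)

∈-powers⁻ : ∀ (xs : List A) n {ys} → ys ∈ powers xs n → All (_∈ xs) ys × length ys ≡ n
∈-powers⁻ xs zero    (here refl) = [] , refl
∈-powers⁻ xs (suc n) ys∈ with ∈-cartesianProductWith⁻ _∷_ xs (powers xs n) ys∈
... | _ , _ , y∈ , zs∈ , refl with ∈-powers⁻ xs n zs∈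
... | all , len = y∈ ∷ all , cong suc len

∈-powers⁺ : ∀ {xs ys : List A} → All (_∈ xs) ys → ys ∈ powers xs (length ys)
∈-powers⁺ []           = here refl
∈-powers⁺ (y∈ ∷ ys⊆xs) = ∈-cartesianProductWith⁺ _∷_ y∈ (∈-powers⁺ ys⊆xs)

∈-powersUpTo⁺ : ∀ n {xs ys : List A} → All (_∈ xs) ys → length ys ℕ.≤ n → ys ∈ powersUpTo xs n
∈-powersUpTo⁺ zero    {ys = []} _     _   = here refl
∈-powersUpTo⁺ (suc n) {xs} {ys} ys⊆xs ys≤ with ℕ.m≤n⇒m<n∨m≡n ys≤
... | inj₁ (ℕ.s≤s ys≤n) = ∈-++⁺ʳ (powers xs (suc n)) (∈-powersUpTo⁺ n ys⊆xs ys≤n)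
... | inj₂ ys≡          = ∈-++⁺ˡ (subst (λ m → ys ∈ powers xs m) ys≡ (∈-powers⁺ ys⊆xs))

module _ {k : ℕ} .{{_ : NonTrivial k}} where

  concatWeight : List (Word k) → ℚ
  concatWeight = weight ∘ concat

  0≤finiteSum : ∀ (ws : List (Word k)) → 0ℚ ℚ.≤ finiteSum ws
  0≤finiteSum = total-nonneg weight 0≤weight

  total-powers : ∀ (ws : List (Word k)) n → total concatWeight (powers ws n) ≡ finiteSum ws ^ n
  total-powers ws zero    = refl
  total-powers ws (suc n) = trans
    (total-product weight concatWeight concatWeight _∷_ (λ w xs → weight-++ w (concat xs)) ws (powers ws n))
    (cong (finiteSum ws ℚ.*_) (total-powers ws n))

  -- The `n`-th power of the sum is the total weight of the products of `n` words of `ws`. Since `X`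
  -- is a code these products are distinct, and each has length at most `n L`, so together they
  -- weigh at most `n L + 1`.
  kraft : ∀ {X : Language k} → IsCode X → ∀ {ws} → FiniteSubset X ws → finiteSum ws ℚ.≤ 1ℚ
  kraft {X} code {ws} (ws! , ws⊆X) = linearly-bounded-powers (finiteSum ws) L λ n → begin
    finiteSum ws ^ n                           ≡⟨ total-powers ws n ⟨
    total concatWeight (powers ws n)           ≡⟨ total-map weight concat (powers ws n) ⟨
    finiteSum (map concat (powers ws n))
      ≤⟨ total-mono-⊆ weight 0≤weight (products-unique n) (products-short n) ⟩
    finiteSum (wordsUpTo (n ℕ.* L))            ≡⟨ finiteSum-wordsUpTo (n ℕ.* L) ⟩
    fromℕ (suc (n ℕ.* L))                      ∎
    where
    open ℚ.≤-Reasoning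
    L = proj₁ (bounded length ws)

    inX : ∀ n {xs} → xs ∈ powers ws n → All X xs
    inX n xs∈ = All.map (All.lookup ws⊆X) (proj₁ (∈-powers⁻ ws n xs∈))

    products-unique : ∀ n → Unique (map concat (powers ws n))
    products-unique n = unique-map concat (λ xs∈ ys∈ → code _ _ (inX n xs∈) (inX n ys∈)) (powers-unique ws! n)

    products-short : ∀ n {w} → w ∈ map concat (powers ws n) → w ∈ wordsUpTo (n ℕ.* L)
    products-short n w∈ with ∈-map⁻ concat w∈
    ... | xs , xs∈ , refl with ∈-powers⁻ ws n xs∈
    ... | xs⊆ws , refl = ∈-wordsUpTo (concat-length-≤ xs (All.map (proj₂ (bounded length ws)) xs⊆ws))

  measure-one-code-maximal : ∀ {X Y : Language k} → HasMeasure X 1ℚ → IsCode Y → X ⊆ Y →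
                             ∀ {y} → Y y → ¬ ¬ X y
  measure-one-code-maximal {X} (_ , dense) codeY X⊆Y {y} y∈Y y∉X
    -- A finite part heavier than `1 - weight y` breaks Kraft's bound as soon as `y` joins it.
    with dense (1ℚ ℚ.- weight y) (subst (1ℚ ℚ.- weight y ℚ.<_) (ℚ.+-identityʳ 1ℚ)
           (ℚ.+-monoʳ-< 1ℚ (ℚ.neg-antimono-< (0<weight y))))
  ... | ws , (ws! , ws⊆X) , 1-y<ws = ℚ.<-irrefl refl (begin-strict
    1ℚ                                  ≡⟨ solve 1 (λ y → con 1ℚ := y :+ (con 1ℚ :- y)) refl (weight y) ⟩
    weight y ℚ.+ (1ℚ ℚ.- weight y)      <⟨ ℚ.+-monoʳ-< (weight y) 1-y<ws ⟩
    weight y ℚ.+ finiteSum ws           ≤⟨ kraft codeY {y ∷ ws} (fresh ∷ ws! , y∈Y ∷ All.map X⊆Y ws⊆X) ⟩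
    1ℚ                                  ∎)
    where
    open ℚ.≤-Reasoning
    open +-*-Solver
    fresh : All (y ≢_) ws
    fresh = All.map (λ x∈X y≡x → y∉X (subst X (sym y≡x) x∈X)) ws⊆X

  -- The geometric sum telescopes against `1 - s` and leaves the nonnegative remainder `s ^ suc n`.
  -- Nothing is divided, so `s` may equal 1.
  geometric-bound : ∀ (ws : List (Word k)) n →
                    total concatWeight (powersUpTo ws n) ℚ.* (1ℚ ℚ.- finiteSum ws) ℚ.≤ 1ℚ
  geometric-bound ws n = begin
    G n ℚ.* (1ℚ ℚ.- s)                    ≡⟨ ℚ.+-identityʳ _ ⟨
    G n ℚ.* (1ℚ ℚ.- s) ℚ.+ 0ℚ             ≤⟨ ℚ.+-monoʳ-≤ (G n ℚ.* (1ℚ ℚ.- s)) (0≤s^ (suc n)) ⟩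
    G n ℚ.* (1ℚ ℚ.- s) ℚ.+ s ^ suc n      ≡⟨ telescope n ⟩
    1ℚ                                    ∎
    where
    open ℚ.≤-Reasoning
    s = finiteSum ws
    G = λ n → total concatWeight (powersUpTo ws n)
    0≤s^ : ∀ n → 0ℚ ℚ.≤ s ^ n
    0≤s^ zero    = 0≤fromℕ 1
    0≤s^ (suc n) = *-nonneg (0≤finiteSum ws) (0≤s^ n)
    telescope : ∀ n → G n ℚ.* (1ℚ ℚ.- s) ℚ.+ s ^ suc n ≡ 1ℚ
    telescope zero    = solve 1 (λ s → (con 1ℚ :+ con 0ℚ) :* (con 1ℚ :- s) :+ s :* con 1ℚ := con 1ℚ) refl s
      where open +-*-Solver
    telescope (suc n) = begin-equality
      total concatWeight (powers ws (suc n) ++ powersUpTo ws n) ℚ.* (1ℚ ℚ.- s) ℚ.+ s ^ suc (suc n)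
        ≡⟨ cong (λ x → x ℚ.* (1ℚ ℚ.- s) ℚ.+ s ^ suc (suc n)) (total-++ concatWeight (powers ws (suc n)) (powersUpTo ws n)) ⟩
      (total concatWeight (powers ws (suc n)) ℚ.+ G n) ℚ.* (1ℚ ℚ.- s) ℚ.+ s ^ suc (suc n)
        ≡⟨ cong (λ x → (x ℚ.+ G n) ℚ.* (1ℚ ℚ.- s) ℚ.+ s ^ suc (suc n)) (total-powers ws (suc n)) ⟩
      (s ^ suc n ℚ.+ G n) ℚ.* (1ℚ ℚ.- s) ℚ.+ s ℚ.* s ^ suc n
        ≡⟨ solve 3 (λ p g s → (p :+ g) :* (con 1ℚ :- s) :+ s :* p := g :* (con 1ℚ :- s) :+ p) refl (s ^ suc n) (G n) s ⟩
      G n ℚ.* (1ℚ ℚ.- s) ℚ.+ s ^ suc n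
        ≡⟨ telescope n ⟩
      1ℚ ∎
      where
        open +-*-Solver

  Context : Set
  Context = Word k × Word k

  -- The inverse of the weight of the context, which undoes the loss of weight caused by filling it.
  scale : Context → ℚ
  scale (u , v) = fromℕ (k ℕ.^ length u) ℚ.* fromℕ (k ℕ.^ length v)

  0≤scale : ∀ c → 0ℚ ℚ.≤ scale c
  0≤scale (u , v) = *-nonneg (0≤fromℕ (k ℕ.^ length u)) (0≤fromℕ (k ℕ.^ length v))

  fill : Context → Word k → Word k
  fill (u , v) w = u ++ w ++ v

  weight-inverse : ∀ (u : Word k) → fromℕ (k ℕ.^ length u) ℚ.* weight u ≡ 1ℚ
  weight-inverse u = fromℕ-*-unit (k ℕ.^ length u) {{ℕ.m^n≢0 k (length u) {{nonTrivial⇒nonZero k}}}}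

  scale-weight : ∀ c w → scale c ℚ.* weight (fill c w) ≡ weight w
  scale-weight (u , v) w = begin
    U ℚ.* V ℚ.* weight (u ++ w ++ v)
      ≡⟨ cong (U ℚ.* V ℚ.*_) (trans (weight-++ u (w ++ v)) (cong (weight u ℚ.*_) (weight-++ w v))) ⟩
    U ℚ.* V ℚ.* (weight u ℚ.* (weight w ℚ.* weight v))
      ≡⟨ solve 5 (λ U V u w v → U :* V :* (u :* (w :* v)) := (U :* u) :* (V :* v) :* w) refl U V (weight u) (weight w) (weight v) ⟩
    (U ℚ.* weight u) ℚ.* (V ℚ.* weight v) ℚ.* weight w
      ≡⟨ cong₂ (λ x y → x ℚ.* y ℚ.* weight w) (weight-inverse u) (weight-inverse v) ⟩
    1ℚ ℚ.* 1ℚ ℚ.* weight w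
      ≡⟨ solve 1 (λ w → con 1ℚ :* con 1ℚ :* w := w) refl (weight w) ⟩
    weight w                                             ∎
    where
    open ≡-Reasoning
    open +-*-Solver
    U = fromℕ (k ℕ.^ length u)
    V = fromℕ (k ℕ.^ length v)

  -- Each word w is charged to a context (u , v) and a factorization of u w v
  -- over X, so the measure n + 1 of all words of length at most n is at most a
  -- constant times 1 + s + s² + ⋯, where s is the measure of a finite part of X.
  finite-contexts⇒dense :
    ∀ {X : Language k} → Decidable X → ¬ X [] →
    (C : List Context) → (∀ w → ∃ λ c → c ∈ C × Star X (fill c w)) →
    ∀ r → r ℚ.< 1ℚ → ∃ λ ws → FiniteSubset X ws × r ℚ.< finiteSum ws
  finite-contexts⇒dense {X} X? []∉X C complete r r<1 =
    ws , (ws! , All.tabulate (λ w∈ → proj₂ (∈-filter⁻ X? {xs = wordsUpTo m} w∈))) , ℚ.≰⇒> contradict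
    where
    K = total scale C
    0<1-r : 0ℚ ℚ.< 1ℚ ℚ.- r
    0<1-r = subst (ℚ._< 1ℚ ℚ.- r) (ℚ.+-inverseʳ r) (ℚ.+-monoˡ-< (ℚ.- r) r<1)
    -- Gives `K < n (1 - r)`, whereas `s ≤ r` would yield `n (1 - r) ≤ K G (1 - s) ≤ K`.
    large = archimedean-* K 0<1-r
    n = proj₁ large
    D = bounded (λ c → length (proj₁ c) ℕ.+ length (proj₂ c)) C
    -- Bounds the length of every filled word, hence both the length and the number of its nonempty
    -- factors.
    m = n ℕ.+ proj₁ D
    ws = filter X? (wordsUpTo m)
    ws! = Unique.filter⁺ X? (wordsUpTo-unique m)
    s = finiteSum ws
    G = total concatWeight (powersUpTo ws m)

    ctx : Word k → Context
    ctx w = proj₁ (complete w)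
    parse : Word k → List (Word k)
    parse w = proj₁ (proj₂ (proj₂ (complete w)))
    parse∈X : ∀ w → All X (parse w)
    parse∈X w = proj₁ (proj₂ (proj₂ (proj₂ (complete w))))
    parse-concat : ∀ w → concat (parse w) ≡ fill (ctx w) w
    parse-concat w = proj₂ (proj₂ (proj₂ (proj₂ (complete w))))

    charge : Word k → Context × List (Word k)
    charge w = ctx w , parse w

    -- The factors spell the filled word; the recorded context can then be cancelled on both sides.
    charge-injective : ∀ {v w} → charge v ≡ charge w → v ≡ w
    charge-injective {v} {w} eq = ++-cancelʳ (proj₂ (ctx v)) v w (++-cancelˡ (proj₁ (ctx v)) _ _ (begin
      fill (ctx v) v       ≡⟨ parse-concat v ⟨
      concat (parse v)     ≡⟨ cong (concat ∘ proj₂) eq ⟩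
      concat (parse w)     ≡⟨ parse-concat w ⟩
      fill (ctx w) w       ≡⟨ cong (λ p → fill (proj₁ p) w) eq ⟨
      fill (ctx v) w       ∎))
      where open ≡-Reasoning

    price : Context × List (Word k) → ℚ
    price (c , xs) = scale c ℚ.* concatWeight xs

    price-charge : ∀ w → price (charge w) ≡ weight w
    price-charge w = trans (cong (λ v → scale (ctx w) ℚ.* weight v) (parse-concat w)) (scale-weight (ctx w) w)

    parse-short : ∀ {w} → length w ℕ.≤ n → length (concat (parse w)) ℕ.≤ m
    parse-short {w} ∣w∣≤n = begin
      length (concat (parse w))                        ≡⟨ cong length (parse-concat w) ⟩
      length (u ++ w ++ v)
        ≡⟨ trans (length-++ u) (cong (length u ℕ.+_) (length-++ w)) ⟩
      length u ℕ.+ (length w ℕ.+ length v)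
        ≡⟨ ℕS.solve 3 (λ a b c → a ℕS.:+ (b ℕS.:+ c) ℕS.:= b ℕS.:+ (a ℕS.:+ c)) refl (length u) (length w) (length v) ⟩
      length w ℕ.+ (length u ℕ.+ length v)
        ≤⟨ ℕ.+-mono-≤ ∣w∣≤n (proj₂ D (proj₁ (proj₂ (complete w)))) ⟩
      m                                                ∎
      where
      open ℕ.≤-Reasoning
      u = proj₁ (ctx w)
      v = proj₂ (ctx w)

    charge-∈ : ∀ {p} → p ∈ map charge (wordsUpTo n) → p ∈ cartesianProduct C (powersUpTo ws m)
    charge-∈ p∈ with ∈-map⁻ charge p∈
    ... | w , w∈ , refl = ∈-cartesianProduct⁺ (proj₁ (proj₂ (complete w)))
      (∈-powersUpTo⁺ m
        (All.tabulate λ x∈ → ∈-filter⁺ X?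
          (∈-wordsUpTo (ℕ.≤-trans (∈-length-≤-concat (parse w) x∈) short)) (All.lookup (parse∈X w) x∈))
        (ℕ.≤-trans (length-≤-concat (parse w) (All.map (λ { x∈X refl → []∉X x∈X }) (parse∈X w))) short))
      where short = parse-short (length-∈-wordsUpTo n w∈)

    count : fromℕ n ℚ.≤ K ℚ.* G
    count = begin
      fromℕ n                                                  ≤⟨ fromℕ-mono-≤ (ℕ.n≤1+n n) ⟩
      fromℕ (suc n)                                            ≡⟨ finiteSum-wordsUpTo n ⟨
      total weight (wordsUpTo n)
        ≡⟨ total-cong (price ∘ charge) price-charge (wordsUpTo n) ⟨
      total (price ∘ charge) (wordsUpTo n)                     ≡⟨ total-map price charge (wordsUpTo n) ⟨
      total price (map charge (wordsUpTo n))
        ≤⟨ total-mono-⊆ price (λ p → *-nonneg (0≤scale (proj₁ p)) (0≤weight (concat (proj₂ p))))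
            (Unique.map⁺ charge-injective (wordsUpTo-unique n)) charge-∈ ⟩
      total price (cartesianProduct C (powersUpTo ws m))
        ≡⟨ total-product scale concatWeight price _,_ (λ _ _ → refl) C (powersUpTo ws m) ⟩
      K ℚ.* G                                                  ∎
      where open ℚ.≤-Reasoning

    0≤K : 0ℚ ℚ.≤ K
    0≤K = total-nonneg scale 0≤scale C

    contradict : ¬ s ℚ.≤ r
    contradict s≤r = ℚ.<-irrefl refl (begin-strict
      K                              <⟨ proj₂ large ⟩
      fromℕ n ℚ.* (1ℚ ℚ.- r)         ≤⟨ *-mono-≤ (0≤fromℕ n) 0≤1-s count 1-r≤1-s ⟩
      K ℚ.* G ℚ.* (1ℚ ℚ.- s)         ≡⟨ ℚ.*-assoc K G (1ℚ ℚ.- s) ⟩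
      K ℚ.* (G ℚ.* (1ℚ ℚ.- s))       ≤⟨ *-mono-≤ 0≤K (0≤fromℕ 1) ℚ.≤-refl (geometric-bound ws m) ⟩
      K ℚ.* 1ℚ                       ≡⟨ ℚ.*-identityʳ K ⟩
      K                              ∎)
      where
      open ℚ.≤-Reasoning
      1-r≤1-s : 1ℚ ℚ.- r ℚ.≤ 1ℚ ℚ.- s
      1-r≤1-s = ℚ.+-monoʳ-≤ 1ℚ (ℚ.neg-antimono-≤ s≤r)
      0≤1-s : 0ℚ ℚ.≤ 1ℚ ℚ.- s
      0≤1-s = ℚ.≤-trans (ℚ.<⇒≤ 0<1-r) 1-r≤1-s

-- Completion of a code

levi : ∀ (u : List A) {v} u′ {v′} → u ++ v ≡ u′ ++ v′ →
       (∃ λ t → u′ ≡ u ++ t × v ≡ t ++ v′) ⊎ (∃ λ t → u ≡ u′ ++ t × v′ ≡ t ++ v)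
levi []      u′       eq = inj₁ (u′ , refl , eq)
levi (a ∷ u) []       eq = inj₂ (a ∷ u , refl , sym eq)
levi (a ∷ u) (b ∷ u′) eq with ∷-injective eq
... | refl , eq′ with levi u u′ eq′
...   | inj₁ (t , u′≡ , v≡) = inj₁ (t , cong (a ∷_) u′≡ , v≡)
...   | inj₂ (t , u≡ , v′≡) = inj₂ (t , cong (a ∷_) u≡ , v′≡)

levi-≤ : ∀ (u : List A) {v} u′ {v′} → length u ℕ.≤ length u′ → u ++ v ≡ u′ ++ v′ →
         ∃ λ t → u′ ≡ u ++ t × v ≡ t ++ v′
levi-≤ []      u′       _             eq = u′ , refl , eq
levi-≤ (a ∷ u) (b ∷ u′) (ℕ.s≤s ∣u∣≤) eq with ∷-injective eq
... | refl , eq′ with levi-≤ u u′ ∣u∣≤ eq′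
...   | t , u′≡ , v≡ = t , cong (a ∷_) u′≡ , v≡

++-≡-length : ∀ (u : List A) {v} u′ {v′} → length u ≡ length u′ → u ++ v ≡ u′ ++ v′ → u ≡ u′ × v ≡ v′
++-≡-length []      []       _   eq = refl , eq
++-≡-length (a ∷ u) (b ∷ u′) len eq with ∷-injective eq
... | refl , eq′ with ++-≡-length u u′ (ℕ.suc-injective len) eq′
...   | u≡ , v≡ = cong (a ∷_) u≡ , v≡

length-≤-++ˡ : ∀ (u v : List A) → length u ℕ.≤ length (u ++ v)
length-≤-++ˡ u v = ℕ.≤-trans (ℕ.m≤m+n (length u) (length v)) (ℕ.≤-reflexive (sym (length-++ u)))

length-≤-++ʳ : ∀ (u v : List A) → length v ℕ.≤ length (u ++ v)
length-≤-++ʳ u v = ℕ.≤-trans (ℕ.m≤n+m (length v) (length u)) (ℕ.≤-reflexive (sym (length-++ u)))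

≢[]⇒0<length : ∀ {u : List A} → u ≢ [] → 0 ℕ.< length u
≢[]⇒0<length {u = []}    u≢[] = ⊥-elim (u≢[] refl)
≢[]⇒0<length {u = _ ∷ _} _    = ℕ.s≤s ℕ.z≤n

starts? : DecidableEquality A → ∀ (y w : List A) → Dec (∃ λ s → w ≡ y ++ s)
starts? _≟_ []      w       = yes (w , refl)
starts? _≟_ (a ∷ y) []      = no λ ()
starts? _≟_ (a ∷ y) (b ∷ w) = map′
  (λ { (refl , s , refl) → s , refl }) (λ { (s , refl) → refl , s , refl })
  ((b ≟ a) ×-dec starts? _≟_ y w)

ends? : DecidableEquality A → ∀ (y w : List A) → Dec (∃ λ p → w ≡ p ++ y)
ends? _≟_ y w with ≡-dec _≟_ w y
... | yes w≡y = yes ([] , w≡y)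
ends? _≟_ y []      | no w≢y = no λ
  { ([]    , w≡y) → w≢y w≡y }
ends? _≟_ y (b ∷ w) | no w≢y = map′
  (λ { (p , refl) → b ∷ p , refl })
  (λ { ([] , w≡y) → ⊥-elim (w≢y w≡y) ; (_ ∷ p , refl) → p , refl })
  (ends? _≟_ y w)

module _ {k : ℕ} where

  star-++ : ∀ {X : Language k} {u v} → Star X u → Star X v → Star X (u ++ v)
  star-++ (xs , xs∈X , refl) (ys , ys∈X , refl) = xs ++ ys , All.++⁺ xs∈X ys∈X , sym (concat-++ xs ys)

  star-⊆ : ∀ {X Y : Language k} → X ⊆ Y → Star X ⊆ Star Y
  star-⊆ X⊆Y (xs , xs∈X , eq) = xs , All.map X⊆Y xs∈X , eq

  star-[_] : ∀ {X : Language k} {w} → X w → Star X w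
  star-[_] {w = w} w∈X = w ∷ [] , w∈X ∷ [] , ++-identityʳ w

  factor-trans : ∀ {u v w : Word k} → u IsFactorOf v → v IsFactorOf w → u IsFactorOf w
  factor-trans {u} (p , s , refl) (p′ , s′ , refl) = p′ ++ p , s ++ s′ , (begin
    p′ ++ (p ++ u ++ s) ++ s′
      ≡⟨ cong (p′ ++_) (trans (++-assoc p (u ++ s) s′) (cong (p ++_) (++-assoc u s s′))) ⟩
    p′ ++ p ++ u ++ s ++ s′         ≡⟨ ++-assoc p′ p _ ⟨
    (p′ ++ p) ++ u ++ s ++ s′       ∎)
    where open ≡-Reasoning

  -- Equivalent to `y` being unbordered. Phrased by shifts: a copy of `y` moved by `p` either
  -- coincides with the original or starts after its end.
  OverlapFree : Word k → Set
  OverlapFree y = ∀ p s → y ++ s ≡ p ++ y → p ≡ [] ⊎ length y ℕ.≤ length p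

-- The Ehrenfeucht–Rozenberg completion of a code X by an overlap-free word y
-- that is not a factor of X*: the added words are those of {y} ∪ (y A* ∩ A* y)
-- that are not a product of two such words separated by a word of X*.
module Completion {k : ℕ} (X : Language k) (codeX : IsCode X)
                  (y : Word k) (y≢[] : y ≢ []) (y-overlap-free : OverlapFree y)
                  (y∤ : ∀ {b} → Star X b → ¬ y IsFactorOf b) where

  Starts Ends Flanked Splits Added Y : Language k
  Starts w  = ∃ λ s → w ≡ y ++ s
  Ends w    = ∃ λ p → w ≡ p ++ y
  Flanked w = Starts w × Ends w
  Splits w  = ∃ λ p → ∃ λ b → ∃ λ q → Flanked p × Star X b × Flanked q × w ≡ p ++ b ++ q
  Added w   = Flanked w × ¬ Splits w
  Y         = X ∪ Added

  y-flanked : Flanked y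
  y-flanked = ([] , sym (++-identityʳ y)) , ([] , refl)

  starts-long : ∀ {w} → Starts w → length y ℕ.≤ length w
  starts-long (s , refl) = length-≤-++ˡ y s

  y∈Added : Added y
  y∈Added = y-flanked , λ
    { (p , b , q , p-fl , _ , q-fl , y≡) → ℕ.<-irrefl refl (begin-strict
        length y                                  <⟨ ℕ.m<n+m (length y) (≢[]⇒0<length y≢[]) ⟩
        length y ℕ.+ length y
          ≤⟨ ℕ.+-mono-≤ (starts-long (proj₁ p-fl)) (ℕ.≤-trans (starts-long (proj₁ q-fl)) (length-≤-++ʳ b q)) ⟩
        length p ℕ.+ length (b ++ q)              ≡⟨ length-++ p ⟨
        length (p ++ b ++ q)                      ≡⟨ cong length y≡ ⟨
        length y                                  ∎) }
    where open ℕ.≤-Reasoning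

  -- Flanked words are split until irreducible, by induction on length. The double negation stands
  -- in for a decision of `Splits`.
  flanked⇒star : ∀ {w} → Flanked w → ¬ ¬ Star Y w
  flanked⇒star {w} = go w (<-wellFounded (length w))
    where
    go : ∀ w → Acc ℕ._<_ (length w) → Flanked w → ¬ ¬ Star Y w
    go w (acc rec) fl w∉Y* = w∉Y* star-[ inj₂ (fl , unsplit) ]
      where
      unsplit : ¬ Splits w
      unsplit (p , b , q , p-fl , b∈X* , q-fl , refl) =
        go p (rec p<w) p-fl λ p∈Y* → go q (rec q<w) q-fl λ q∈Y* →
        w∉Y* (star-++ p∈Y* (star-++ (star-⊆ inj₁ b∈X*) q∈Y*))
        where
        open ℕ.≤-Reasoning
        0<y = ≢[]⇒0<length y≢[]
        p<w : length p ℕ.< length (p ++ b ++ q)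
        p<w = begin-strict
          length p
            <⟨ ℕ.m<m+n (length p) (ℕ.<-≤-trans 0<y (ℕ.≤-trans (starts-long (proj₁ q-fl)) (length-≤-++ʳ b q))) ⟩
          length p ℕ.+ length (b ++ q)      ≡⟨ length-++ p ⟨
          length (p ++ b ++ q)              ∎
        q<w : length q ℕ.< length (p ++ b ++ q)
        q<w = begin-strict
          length q                          ≤⟨ length-≤-++ʳ b q ⟩
          length (b ++ q)                   <⟨ ℕ.m<n+m _ (ℕ.<-≤-trans 0<y (starts-long (proj₁ p-fl))) ⟩
          length p ℕ.+ length (b ++ q)      ≡⟨ length-++ p ⟨
          length (p ++ b ++ q)              ∎

  -- y x y is flanked for every x, so any x in a larger code Z appears in two
  -- factorizations of y x y over Z unless x is already in Y.
  Y-maximal : Decidable X → ∀ {Z : Language k} → IsCode Z → Y ⊆ Z → Z ⊆ Y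
  Y-maximal X? {Z} codeZ Y⊆Z {x} x∈Z with X? x
  ... | yes x∈X = inj₁ x∈X
  -- Of the two halves of `Added`, being flanked is decidable and being unsplit is a negation, so
  -- both follow from the doubly negated membership.
  ... | no  x∉X = inj₂ (fl , λ splits → ¬¬x∈Y λ { (inj₁ x∈X) → x∉X x∈X ; (inj₂ (_ , unsplit)) → unsplit splits })
    where
    ¬¬x∈Y : ¬ ¬ Y x
    ¬¬x∈Y x∉Y = flanked⇒star {y ++ x ++ y} ((x ++ y , refl) , (y ++ x , sym (++-assoc y x y))) λ
      { (ws , ws∈Y , eq) → case codeZ (y ∷ x ∷ y ∷ []) ws
            (Y⊆Z (inj₂ y∈Added) ∷ x∈Z ∷ Y⊆Z (inj₂ y∈Added) ∷ []) (All.map Y⊆Z ws∈Y)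
            (trans (cong (λ v → y ++ x ++ v) (++-identityʳ y)) (sym eq)) of λ
          { refl → case ws∈Y of λ { (_ ∷ x∈Y ∷ _) → x∉Y x∈Y } } }
    fl : Flanked x
    fl = decidable-stable (starts? Fin._≟_ y x ×-dec ends? Fin._≟_ y x) λ ¬fl →
      ¬¬x∈Y λ { (inj₁ x∈X) → x∉X x∈X ; (inj₂ (fl , _)) → ¬fl fl }

  -- An occurrence of `y` that starts inside `b` either lies within `b`, against `y∤`, or straddles
  -- its end and overlaps the `y` that follows, against overlap-freeness.
  first-occurrence : ∀ {b} → Star X b → ∀ p {r s} → b ++ y ++ r ≡ p ++ y ++ s →
                     ∃ λ p′ → p ≡ b ++ p′ × y ++ r ≡ p′ ++ y ++ s
  first-occurrence {b} b∈X* p {r} {s} eq with levi b p eq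
  ... | inj₁ found = found
  ... | inj₂ (t , b≡p++t , y++s≡t++y++r) with levi y t y++s≡t++y++r
  ...   | inj₁ (t′ , t≡y++t′ , _) = ⊥-elim (y∤ b∈X* (p , t′ , trans b≡p++t (cong (p ++_) t≡y++t′)))
  ...   | inj₂ (y′ , y≡t++y′ , y++r≡y′++s) with levi-≤ y′ y
            (subst (λ v → length y′ ℕ.≤ length v) (sym y≡t++y′) (length-≤-++ʳ t y′)) (sym y++r≡y′++s)
  ...     | s′ , y≡y′++s′ , _ with y-overlap-free t s′ (begin
              y ++ s′            ≡⟨ cong (_++ s′) y≡t++y′ ⟩
              (t ++ y′) ++ s′    ≡⟨ ++-assoc t y′ s′ ⟩
              t ++ y′ ++ s′      ≡⟨ cong (t ++_) y≡y′++s′ ⟨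
              t ++ y             ∎)
            where open ≡-Reasoning
  ...       | inj₁ refl = [] , trans (sym (trans b≡p++t (++-identityʳ p))) (sym (++-identityʳ b)) , sym y++s≡t++y++r
  ...       | inj₂ ∣y∣≤∣t∣ with levi-≤ y t ∣y∣≤∣t∣ y++s≡t++y++r
  ...         | t′ , t≡y++t′ , _ = ⊥-elim (y∤ b∈X* (p , t′ , trans b≡p++t (cong (p ++_) t≡y++t′)))

  -- Otherwise the last `y` of `z ++ t` would reach back into the last `y` of `z` and overlap it
  -- properly.
  ends-suffix : ∀ {z} t → t ≢ [] → Ends z → Ends (z ++ t) → Ends t
  ends-suffix {z} t t≢[] (p₂ , refl) (p₁ , eq) with levi (p₂ ++ y) p₁ eq
  ... | inj₁ (q , _ , t≡q++y) = q , t≡q++y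
  ... | inj₂ (y′ , p₂++y≡p₁++y′ , y≡y′++t) with levi p₂ p₁ p₂++y≡p₁++y′
  ...   | inj₂ (q , _ , refl) = ⊥-elim (ℕ.<-irrefl refl (begin-strict
            length y                       <⟨ ℕ.m<m+n (length y) (≢[]⇒0<length t≢[]) ⟩
            length y ℕ.+ length t          ≤⟨ ℕ.+-monoˡ-≤ (length t) (length-≤-++ʳ q y) ⟩
            length (q ++ y) ℕ.+ length t   ≡⟨ length-++ (q ++ y) ⟨
            length ((q ++ y) ++ t)         ≡⟨ cong length y≡y′++t ⟨
            length y                       ∎))
            where open ℕ.≤-Reasoning
  ...   | inj₁ (q , _ , y≡q++y′) with y-overlap-free q t (begin
            y ++ t             ≡⟨ cong (_++ t) y≡q++y′ ⟩
            (q ++ y′) ++ t     ≡⟨ ++-assoc q y′ t ⟩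
            q ++ y′ ++ t       ≡⟨ cong (q ++_) y≡y′++t ⟨
            q ++ y             ∎)
          where open ≡-Reasoning
  ...     | inj₁ refl = ⊥-elim (t≢[] (++-cancelˡ y t []
            (trans (cong (_++ t) y≡q++y′) (trans (sym y≡y′++t) (sym (++-identityʳ y))))))
  ...     | inj₂ ∣y∣≤∣q∣ with levi-≤ y q ∣y∣≤∣q∣ (trans (++-identityʳ y) y≡q++y′)
  ...       | e , _ , []≡e++y′ with ++-conicalʳ e y′ (sym []≡e++y′)
  ...         | refl = [] , sym y≡y′++t

  -- A view of a factorization over `Y` that cuts it at its first added word, if there is one.
  data Blocks : List (Word k) → Set where
    base  : ∀ {bs} → All X bs → Blocks bs
    block : ∀ {bs z ws} → All X bs → Added z → All Y ws → Blocks (bs ++ z ∷ ws)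

  blocks : ∀ {ws} → All Y ws → Blocks ws
  blocks []                     = base []
  blocks (inj₂ z∈ ∷ ws∈)        = block [] z∈ ws∈
  blocks (inj₁ x∈ ∷ ws∈) with blocks ws∈
  ... | base bs∈          = base (x∈ ∷ bs∈)
  ... | block bs∈ z∈ ws∈′ = block (x∈ ∷ bs∈) z∈ ws∈′

  concat-block : ∀ bs s ws → concat (bs ++ (y ++ s) ∷ ws) ≡ concat bs ++ y ++ s ++ concat ws
  concat-block bs s ws = trans (sym (concat-++ bs ((y ++ s) ∷ ws))) (cong (concat bs ++_) (++-assoc y s (concat ws)))

  all⇒star : ∀ {bs} → All X bs → Star X (concat bs)
  all⇒star {bs} bs∈ = bs , bs∈ , refl

  -- Here `t` is `q ++ y`, so the product of `ws` contains `y` and has a first added word, after a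
  -- product `b` over `X`. No `y` starts before the end of `b`, hence `t` is `b` followed by a
  -- flanked word, and `z ++ t` splits as `z`, `b` and that word.
  added-not-extended : ∀ {z t ws m} → Flanked z → t ≢ [] → Added (z ++ t) → All Y ws → concat ws ≢ t ++ m
  added-not-extended {z} {t} {m = m} z-fl t≢[] z′∈ ws∈ eq
    with ends-suffix t t≢[] (proj₂ z-fl) (proj₂ (proj₁ z′∈)) | blocks ws∈
  ... | q , refl | base bs∈ = y∤ (all⇒star bs∈) (q , m , trans eq (++-assoc q y m))
  ... | q , refl | block {bs} {ws = ws} bs∈ (((s , refl) , _) , _) _
    with first-occurrence (all⇒star bs∈) q (trans (sym (concat-block bs s ws)) (trans eq (++-assoc q y m)))
  ... | q′ , refl , eq′ with levi-≤ y (q′ ++ y) (length-≤-++ʳ q′ y) (trans eq′ (sym (++-assoc q′ y m)))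
  ... | e , q′++y≡y++e , _ = proj₂ z′∈
          (z , concat bs , q′ ++ y , z-fl , all⇒star bs∈ , ((e , q′++y≡y++e) , (q′ , refl)) ,
           cong (z ++_) (++-assoc (concat bs) q′ y))

  added-cancel : ∀ {z z′ us vs} → Added z → Added z′ → All Y us → All Y vs →
                 z ++ concat us ≡ z′ ++ concat vs → z ≡ z′ × concat us ≡ concat vs
  added-cancel {z} {z′} z∈ z′∈ us∈ vs∈ eq with levi z z′ eq
  ... | inj₁ ([]        , refl , us≡) = sym (++-identityʳ z) , us≡
  ... | inj₁ (t@(_ ∷ _) , refl , us≡) = ⊥-elim (added-not-extended {t = t} (proj₁ z∈) (λ ()) z′∈ us∈ us≡)
  ... | inj₂ ([]        , refl , vs≡) = ++-identityʳ z′ , sym vs≡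
  ... | inj₂ (t@(_ ∷ _) , refl , vs≡) = ⊥-elim (added-not-extended {t = t} (proj₁ z′∈) (λ ()) z∈ vs∈ vs≡)

  base≢block : ∀ {as bs s vs} → All X as → concat as ≢ concat (bs ++ (y ++ s) ∷ vs)
  base≢block {bs = bs} {s} {vs} as∈ eq = y∤ (all⇒star as∈) (concat bs , s ++ concat vs , trans eq (concat-block bs s vs))

  -- The first `y` on either side comes right after the leading product over `X`, so these products
  -- agree and the code property of `X` identifies their factors. The first added words then agree
  -- because neither extends the other, and the shorter remainders are compared.
  Y-code : IsCode Y
  Y-code us vs us∈ vs∈ eq = go us vs (<-wellFounded (length us)) us∈ vs∈ eq
    where
    go : ∀ us vs → Acc ℕ._<_ (length us) → All Y us → All Y vs → concat us ≡ concat vs → us ≡ vs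
    go us vs (acc rec) us∈ vs∈ eq with blocks us∈ | blocks vs∈
    ... | base as∈ | base bs∈ = codeX _ _ as∈ bs∈ eq
    ... | base as∈ | block {bs} bs∈ (((s , refl) , _) , _) _ = ⊥-elim (base≢block {bs = bs} as∈ eq)
    ... | block {as} as∈ (((s , refl) , _) , _) _ | base bs∈ = ⊥-elim (base≢block {bs = as} bs∈ (sym eq))
    ... | block {as} {ws = us′} as∈ z∈@(((s , refl) , _) , _) us′∈
        | block {bs} {ws = vs′} bs∈ z′∈@(((s′ , refl) , _) , _) vs′∈
      with trans (sym (concat-block as s us′)) (trans eq (concat-block bs s′ vs′))
    ... | eq′ with first-occurrence (all⇒star as∈) (concat bs) eq′
                 | first-occurrence (all⇒star bs∈) (concat as) (sym eq′)
    ... | t , bs≡as++t , rest | t′ , as≡bs++t′ , _ with ++-≡-length (concat as) (concat bs)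
            (ℕ.≤-antisym (subst (λ v → length (concat as) ℕ.≤ length v) (sym bs≡as++t) (length-≤-++ˡ (concat as) t))
                         (subst (λ v → length (concat bs) ℕ.≤ length v) (sym as≡bs++t′) (length-≤-++ˡ (concat bs) t′))) eq′
    ... | as≡bs , tails with codeX as bs as∈ bs∈ as≡bs
                           | added-cancel z∈ z′∈ us′∈ vs′∈ (trans (++-assoc y s _) (trans tails (sym (++-assoc y s′ _))))
    ... | refl | z≡z′ , us′≡vs′ = cong₂ (λ z ws → as ++ z ∷ ws) z≡z′
            (go us′ vs′ (rec shorter) us′∈ vs′∈ us′≡vs′)
      where
      shorter : length us′ ℕ.< length (as ++ (y ++ s) ∷ us′)
      shorter = length-≤-++ʳ as ((y ++ s) ∷ us′)

-- Automorphisms and anti-automorphisms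

replicate-∷ʳ : ∀ n (b : A) → replicate n b ++ b ∷ [] ≡ b ∷ replicate n b
replicate-∷ʳ zero    b = refl
replicate-∷ʳ (suc n) b = cong (b ∷_) (replicate-∷ʳ n b)

-- If y occurs in y s at a position d < |g|, it also occurs at 2d in y s s;
-- doubling d until |g| ≤ d < 2 |g| puts the first letter a against a letter b.
padded-overlap-free : ∀ {k} {a b : Fin k} → a ≢ b → ∀ g′ → let g = a ∷ g′ in
                      OverlapFree (g ++ replicate (length g) b)
padded-overlap-free {k} {a} {b} a≢b g′ []        s eq = inj₁ refl
padded-overlap-free {k} {a} {b} a≢b g′ p@(_ ∷ _) s eq = inj₂ (go p (λ ()) s eq (<-wellFounded _))
  where
  g = a ∷ g′
  N = length g
  y = g ++ replicate N b

  ∣y∣≡2N : length y ≡ N ℕ.+ N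
  ∣y∣≡2N = trans (length-++ g) (cong (N ℕ.+_) (length-replicate N))

  clash : ∀ p s → y ++ s ≡ p ++ y → N ℕ.≤ length p → length y ℕ.≤ length p
  clash p s eq N≤p with levi-≤ g p N≤p (trans (sym (++-assoc g (replicate N b) s)) eq)
  ... | q , refl , eq′ with levi (replicate N b) q eq′
  ...   | inj₁ (t , refl , _) = begin
            length y                           ≤⟨ length-≤-++ˡ y t ⟩
            length (y ++ t)                    ≡⟨ cong length (++-assoc g (replicate N b) t) ⟩
            length (g ++ replicate N b ++ t)   ∎
          where open ℕ.≤-Reasoning
  ...   | inj₂ ([] , bs≡q , _) = ℕ.≤-reflexive (cong (λ v → length (g ++ v)) (trans bs≡q (++-identityʳ q)))
  ...   | inj₂ (c ∷ t , bs≡q++c∷t , y≡c∷t++s) with ∷-injectiveˡ y≡c∷t++s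
  ...     | refl = ⊥-elim (a≢b (All.lookup (All.replicate⁺ {P = _≡ b} N refl)
                     (subst (a ∈_) (sym bs≡q++c∷t) (∈-++⁺ʳ q (here refl)))))

  go : ∀ p → p ≢ [] → ∀ s → y ++ s ≡ p ++ y → Acc ℕ._<_ (N ℕ.∸ length p) → length y ℕ.≤ length p
  go p p≢[] s eq (acc rec) with N ℕ.≤? length p
  ... | yes N≤p = clash p s eq N≤p
  -- The doubled shift stays below `2N`, the length of `y`, so the conclusion of the recursive call
  -- is absurd.
  ... | no  N≰p = ⊥-elim (ℕ.<-irrefl refl (begin-strict
      length y
        ≤⟨ go (p ++ p) (λ pp≡[] → p≢[] (++-conicalˡ p p pp≡[])) (s ++ s) doubled (rec closer) ⟩
      length (p ++ p)                ≡⟨ length-++ p ⟩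
      length p ℕ.+ length p          <⟨ ℕ.+-mono-< p<N p<N ⟩
      N ℕ.+ N                        ≡⟨ ∣y∣≡2N ⟨
      length y                       ∎))
    where
    p<N = ℕ.≰⇒> N≰p
    doubled : y ++ s ++ s ≡ (p ++ p) ++ y
    doubled = trans (sym (++-assoc y s s)) (trans (cong (_++ s) eq) (trans (++-assoc p y s)
      (trans (cong (p ++_) eq) (sym (++-assoc p p y)))))
    closer : N ℕ.∸ length (p ++ p) ℕ.< N ℕ.∸ length p
    closer = ℕ.≤-<-trans
      (ℕ.∸-monoʳ-≤ N (ℕ.<-≤-trans (ℕ.m<m+n (length p) (≢[]⇒0<length p≢[])) (ℕ.≤-reflexive (sym (length-++ p)))))
      (ℕ.∸-monoʳ-< (ℕ.n<1+n (length p)) p<N)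
    open ℕ.≤-Reasoning

module _ {k : ℕ} where

  Hom AntiHom : (Word k → Word k) → Set
  Hom f     = ∀ u v → f (u ++ v) ≡ f u ++ f v
  AntiHom f = ∀ u v → f (u ++ v) ≡ f v ++ f u

  module _ (f : Word k → Word k) (f-hom : Hom f) (f-inj : ∀ {u v} → f u ≡ f v → u ≡ v) where

    hom-[] : f [] ≡ []
    hom-[] = ++-cancelˡ (f []) (f []) [] (trans (sym (f-hom [] [])) (sym (++-identityʳ (f []))))

    -- An injective homomorphism erases no letter.
    expanding : ∀ w → length w ℕ.≤ length (f w)
    expanding []      = ℕ.z≤n
    expanding (a ∷ w) = begin
      suc (length w)                             ≤⟨ ℕ.+-mono-≤ (≢[]⇒0<length f[a]≢[]) (expanding w) ⟩
      length (f (a ∷ [])) ℕ.+ length (f w)       ≡⟨ length-++ (f (a ∷ [])) ⟨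
      length (f (a ∷ []) ++ f w)                 ≡⟨ cong length (f-hom (a ∷ []) w) ⟨
      length (f (a ∷ w))                         ∎
      where
      open ℕ.≤-Reasoning
      f[a]≢[] : f (a ∷ []) ≢ []
      f[a]≢[] eq = case f-inj (trans eq (sym hom-[])) of λ ()

    letterwise : (∀ a → ∃ λ b → f (a ∷ []) ≡ b ∷ []) → ∃ λ (σ : Fin k → Fin k) → ∀ w → f w ≡ map σ w
    letterwise letter = σ , agree
      where
      σ : Fin k → Fin k
      σ a = proj₁ (letter a)
      agree : ∀ w → f w ≡ map σ w
      agree []      = hom-[]
      agree (a ∷ w) = trans (f-hom (a ∷ []) w) (cong₂ _++_ (proj₂ (letter a)) (agree w))

  -- Neither `f` nor its inverse `g` shortens a word, so both send letters to letters.
  bijective-hom⇒map : ∀ (f g : Word k → Word k) → Hom f →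
                      (∀ w → g (f w) ≡ w) → (∀ w → f (g w) ≡ w) →
                      ∃₂ λ (σ ρ : Fin k → Fin k) → (∀ w → f w ≡ map σ w) ×
                        (∀ w → map ρ (map σ w) ≡ w) × (∀ w → map σ (map ρ w) ≡ w)
  bijective-hom⇒map f g f-hom gf fg = proj₁ F , proj₁ G , proj₂ F
    , (λ w → trans (sym (proj₂ G (map (proj₁ F) w))) (trans (cong g (sym (proj₂ F w))) (gf w)))
    , (λ w → trans (sym (proj₂ F (map (proj₁ G) w))) (trans (cong f (sym (proj₂ G w))) (fg w)))
    where
    f-inj : ∀ {u v} → f u ≡ f v → u ≡ v
    f-inj {u} {v} eq = trans (sym (gf u)) (trans (cong g eq) (gf v))
    g-inj : ∀ {u v} → g u ≡ g v → u ≡ v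
    g-inj {u} {v} eq = trans (sym (fg u)) (trans (cong f eq) (fg v))
    g-hom : Hom g
    g-hom u v = f-inj (trans (fg (u ++ v)) (sym (trans (f-hom (g u) (g v)) (cong₂ _++_ (fg u) (fg v)))))
    length-one : ∀ {w : Word k} → length w ≡ 1 → ∃ λ b → w ≡ b ∷ []
    length-one {b ∷ []} refl = b , refl
    f-letter : ∀ a → ∃ λ b → f (a ∷ []) ≡ b ∷ []
    f-letter a = length-one (ℕ.≤-antisym
      (subst (λ w → length (f (a ∷ [])) ℕ.≤ length w) (gf (a ∷ [])) (expanding g g-hom g-inj (f (a ∷ []))))
      (expanding f f-hom f-inj (a ∷ [])))
    g-letter : ∀ a → ∃ λ b → g (a ∷ []) ≡ b ∷ []
    g-letter a = length-one (ℕ.≤-antisym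
      (subst (λ w → length (g (a ∷ [])) ℕ.≤ length w) (fg (a ∷ [])) (expanding f f-hom f-inj (g (a ∷ []))))
      (expanding g g-hom g-inj (a ∷ [])))
    F = letterwise f f-hom f-inj f-letter
    G = letterwise g g-hom g-inj g-letter

  -- A normal form: a letter permutation `σ` with inverse `ρ`, followed by reversal in the anti
  -- case. The inverse laws are stated on words, the form in which the bijectivity of `θ` supplies
  -- them.
  record Symmetry (θ : Word k → Word k) : Set where
    field
      σ ρ    : Fin k → Fin k
      ρσ     : ∀ w → map ρ (map σ w) ≡ w
      σρ     : ∀ w → map σ (map ρ w) ≡ w
      shape  : (∀ w → θ w ≡ map σ w) ⊎ (∀ w → θ w ≡ reverse (map σ w))

  -- An anti-automorphism becomes a bijective homomorphism when followed by `reverse`, which reduces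
  -- the second case to the first.
  symmetry : ∀ (θ : Word k → Word k) → IsAutomorphism θ ⊎ IsAntiAutomorphism θ → Symmetry θ
  symmetry θ (inj₁ iso) =
    let σ , ρ , θ≗ , ρσ , σρ = bijective-hom⇒map θ θ⁻¹ homo (λ w → injective (θθ⁻¹ (θ w))) θθ⁻¹
    in record { σ = σ ; ρ = ρ ; ρσ = ρσ ; σρ = σρ ; shape = inj₁ θ≗ }
    where
    open MonoidMorphisms.IsMonoidIsomorphism iso
    θ⁻¹ : Word k → Word k
    θ⁻¹ w = proj₁ (surjective w)
    θθ⁻¹ : ∀ w → θ (θ⁻¹ w) ≡ w
    θθ⁻¹ w = proj₂ (surjective w) refl
  symmetry θ (inj₂ ((inj , surj) , anti)) =
    let σ , ρ , rθ≗ , ρσ , σρ = bijective-hom⇒map (reverse ∘ θ) (θ⁻¹ ∘ reverse)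
          (λ u v → trans (cong reverse (anti u v)) (reverse-++ (θ v) (θ u)))
          (λ w → trans (cong θ⁻¹ (reverse-involutive (θ w))) (inj (θθ⁻¹ (θ w))))
          (λ w → trans (cong reverse (θθ⁻¹ (reverse w))) (reverse-involutive w))
    in record { σ = σ ; ρ = ρ ; ρσ = ρσ ; σρ = σρ
              ; shape = inj₂ λ w → trans (sym (reverse-involutive (θ w))) (cong reverse (rθ≗ w)) }
    where
    θ⁻¹ : Word k → Word k
    θ⁻¹ w = proj₁ (surj w)
    θθ⁻¹ : ∀ w → θ (θ⁻¹ w) ≡ w
    θθ⁻¹ w = proj₂ (surj w) refl

  twist-factor : ∀ (σ : Fin k → Fin k) (f : Word k → Word k) →
                 (∀ w → f w ≡ map σ w) ⊎ (∀ w → f w ≡ reverse (map σ w)) →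
                 ∀ {u w} → u IsFactorOf w → f u IsFactorOf f w
  twist-factor σ f (inj₁ f≗) {u} (p , s , refl) = map σ p , map σ s , (begin
    f (p ++ u ++ s)                      ≡⟨ f≗ (p ++ u ++ s) ⟩
    map σ (p ++ u ++ s)
      ≡⟨ trans (map-++ σ p (u ++ s)) (cong (map σ p ++_) (map-++ σ u s)) ⟩
    map σ p ++ map σ u ++ map σ s        ≡⟨ cong (λ v → map σ p ++ v ++ map σ s) (f≗ u) ⟨
    map σ p ++ f u ++ map σ s            ∎)
    where open ≡-Reasoning
  twist-factor σ f (inj₂ f≗) {u} (p , s , refl) = f s , f p , (begin
    f (p ++ u ++ s)                      ≡⟨ anti p (u ++ s) ⟩
    f (u ++ s) ++ f p                    ≡⟨ cong (_++ f p) (anti u s) ⟩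
    (f s ++ f u) ++ f p                  ≡⟨ ++-assoc (f s) (f u) (f p) ⟩
    f s ++ f u ++ f p                    ∎)
    where
    open ≡-Reasoning
    anti : AntiHom f
    anti u v = begin
      f (u ++ v)                                   ≡⟨ f≗ (u ++ v) ⟩
      reverse (map σ (u ++ v))                     ≡⟨ cong reverse (map-++ σ u v) ⟩
      reverse (map σ u ++ map σ v)                 ≡⟨ reverse-++ (map σ u) (map σ v) ⟩
      reverse (map σ v) ++ reverse (map σ u)       ≡⟨ cong₂ _++_ (f≗ v) (f≗ u) ⟨
      f v ++ f u                                   ∎

distinct-letters : ∀ k .{{_ : NonTrivial k}} → ∃₂ λ (a b : Fin k) → a ≢ b
distinct-letters k = go k (ℕ.nonTrivial⇒n>1 k)
  where
  go : ∀ k → 1 ℕ.< k → ∃₂ λ (a b : Fin k) → a ≢ b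
  go (suc (suc k)) _ = Fin.zero , Fin.suc Fin.zero , λ ()
  go (suc zero) (ℕ.s≤s ())

module SymmetryProperties {k : ℕ} {θ : Word k → Word k} (S : Symmetry θ) where
  open Symmetry S

  θ⁻¹ : Word k → Word k
  θ⁻¹ = [ (λ _ → map ρ) , (λ _ → reverse ∘ map ρ) ]′ shape

  θ⁻¹-shape : (∀ w → θ⁻¹ w ≡ map ρ w) ⊎ (∀ w → θ⁻¹ w ≡ reverse (map ρ w))
  θ⁻¹-shape with shape
  ... | inj₁ _ = inj₁ λ _ → refl
  ... | inj₂ _ = inj₂ λ _ → refl

  θ⁻¹∘θ : ∀ w → θ⁻¹ (θ w) ≡ w
  θ⁻¹∘θ w with shape
  ... | inj₁ θ≗ = trans (cong (map ρ) (θ≗ w)) (ρσ w)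
  ... | inj₂ θ≗ = trans (cong (reverse ∘ map ρ) (θ≗ w))
    (trans (cong reverse (reverse-map ρ (map σ w))) (trans (reverse-involutive _) (ρσ w)))

  θ∘θ⁻¹ : ∀ w → θ (θ⁻¹ w) ≡ w
  θ∘θ⁻¹ w with shape
  ... | inj₁ θ≗ = trans (θ≗ (map ρ w)) (σρ w)
  ... | inj₂ θ≗ = trans (θ≗ (reverse (map ρ w)))
    (trans (cong reverse (reverse-map σ (map ρ w))) (trans (reverse-involutive _) (σρ w)))

  θ-factor : ∀ {u w} → u IsFactorOf w → θ u IsFactorOf θ w
  θ-factor = twist-factor σ θ shape

  θ⁻¹-factor : ∀ {u w} → u IsFactorOf w → θ⁻¹ u IsFactorOf θ⁻¹ w
  θ⁻¹-factor = twist-factor ρ θ⁻¹ θ⁻¹-shape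

  -- `θ` preserves length, and the prefix of `θ z` as long as `y` is the image of the prefix `y` of
  -- `z` for an automorphism, of the suffix `y` for an anti-automorphism. This is why both flanks
  -- are required.
  flank-fixed : ∀ {y z s p s′} → z ≡ y ++ s → z ≡ p ++ y → θ z ≡ y ++ s′ → θ y ≡ y
  flank-fixed {y} {z} {s} {p} z≡ z≡′ θz≡ with shape
  ... | inj₁ θ≗ = trans (θ≗ y) (proj₁ (++-≡-length (map σ y) y (length-map σ y)
          (trans (sym (map-++ σ y s)) (trans (cong (map σ) (sym z≡)) (trans (sym (θ≗ z)) θz≡)))))
  ... | inj₂ θ≗ = trans (θ≗ y) (proj₁ (++-≡-length (reverse (map σ y)) y
          (trans (length-reverse (map σ y)) (length-map σ y))
          (trans (sym (reverse-++ (map σ p) (map σ y)))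
            (trans (cong reverse (trans (sym (map-++ σ p y)) (cong (map σ) (sym z≡′))))
              (trans (sym (θ≗ z)) θz≡)))))

  -- For an automorphism, `a` is a moved letter and `b` its image, so `θ y` starts with `b` and not
  -- `a`. For an anti-automorphism, the final `b b` makes `θ y` start with a repeated letter, while
  -- `y` starts with the distinct letters `a b`.
  moved-letters : .{{_ : NonTrivial k}} → ∃₂ λ a b → a ≢ b ×
    ((∀ w → θ w ≡ w) ⊎ (∀ t n → let y = (a ∷ b ∷ t) ++ replicate (suc (suc n)) b in θ y ≢ y))
  moved-letters with shape
  ... | inj₁ θ≗ with Fin.all? (λ a → σ a Fin.≟ a)
  ...   | yes σ≗id = let a , b , a≢b = distinct-letters k in a , b , a≢b ,
            inj₁ λ w → trans (θ≗ w) (trans (map-cong σ≗id w) (map-id w))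
  ...   | no  σ≢id = let a , σa≢a = Fin.¬∀⟶∃¬ k _ (λ a → σ a Fin.≟ a) σ≢id in a , σ a , σa≢a ∘ sym ,
            inj₂ λ t n θy≡y → σa≢a (∷-injectiveˡ (trans (sym (θ≗ _)) θy≡y))
  moved-letters | inj₂ θ≗ = let a , b , a≢b = distinct-letters k in a , b , a≢b , inj₂ λ t n θy≡y →
    case trans (sym (reversed a b t n)) (trans (sym (θ≗ _)) θy≡y) of λ
      eq → a≢b (trans (sym (∷-injectiveˡ eq)) (∷-injectiveˡ (∷-injectiveʳ eq)))
    where
    open ≡-Reasoning
    reversed : ∀ a b t n → reverse (map σ ((a ∷ b ∷ t) ++ replicate (suc (suc n)) b)) ≡
               σ b ∷ σ b ∷ reverse (map σ ((a ∷ b ∷ t) ++ replicate n b))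
    reversed a b t n = begin
      reverse (map σ (u ++ replicate (suc (suc n)) b))
        ≡⟨ cong (λ v → reverse (map σ (u ++ v))) (begin
             b ∷ replicate (suc n) b                  ≡⟨ cong (b ∷_) (replicate-∷ʳ n b) ⟨
             replicate (suc n) b ++ b ∷ []            ≡⟨ cong (_++ b ∷ []) (replicate-∷ʳ n b) ⟨
             (replicate n b ++ b ∷ []) ++ b ∷ []      ≡⟨ ++-assoc (replicate n b) (b ∷ []) (b ∷ []) ⟩
             replicate n b ++ b ∷ b ∷ []              ∎) ⟩
      reverse (map σ (u ++ replicate n b ++ b ∷ b ∷ []))
        ≡⟨ cong (reverse ∘ map σ) (++-assoc u (replicate n b) (b ∷ b ∷ [])) ⟨
      reverse (map σ ((u ++ replicate n b) ++ b ∷ b ∷ []))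
        ≡⟨ cong reverse (map-++ σ (u ++ replicate n b) (b ∷ b ∷ [])) ⟩
      reverse (map σ (u ++ replicate n b) ++ σ b ∷ σ b ∷ [])
        ≡⟨ reverse-++ (map σ (u ++ replicate n b)) (σ b ∷ σ b ∷ []) ⟩
      σ b ∷ σ b ∷ reverse (map σ (u ++ replicate n b)) ∎
      where u = a ∷ b ∷ t

  -- Independence is an implication from `X` to `Y`, so the same construction serves codes of
  -- measure one, whose independence is not assumed.
  record CodeCompletion (X : Language k) : Set₁ where
    field
      Y           : Language k
      X⊆Y         : X ⊆ Y
      code        : IsCode Y
      new         : ∃ λ y → Y y × ¬ X y
      independent : Independent (graphOffFixedPoints θ) X → Independent (graphOffFixedPoints θ) Y
      maximal     : ∀ {Z : Language k} → IsCode Z → Y ⊆ Z → Z ⊆ Y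

  complete-code : .{{_ : NonTrivial k}} → ∀ {X : Language k} → IsCode X → Decidable X →
                  ∀ w → (∀ {b} → Star X b → ¬ w IsFactorOf b) → CodeCompletion X
  complete-code {X} codeX X? w w∤ = record
    { Y = Y ; X⊆Y = inj₁ ; code = Y-code
    ; new = y , inj₂ y∈Added , λ y∈X → y∤ star-[ y∈X ] ([] , [] , sym (++-identityʳ y))
    ; independent = independent
    ; maximal = Y-maximal X?
    }
    where
    a = proj₁ moved-letters
    b = proj₁ (proj₂ moved-letters)
    a≢b = proj₁ (proj₂ (proj₂ moved-letters))
    -- The factor `w` keeps `y` out of `X*`. If `θ x` is new for some `x` in `X`, then `θ w` is a
    -- factor of `θ x`, so `w` is one of `x`; if a new `x` has `θ x` in `X`, then `θ⁻¹ w` is a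
    -- factor of `x`, so `w` is one of `θ x`.
    t = w ++ θ w ++ θ⁻¹ w
    g = a ∷ b ∷ t
    y = g ++ replicate (length g) b

    w-factor : w IsFactorOf y
    w-factor = a ∷ b ∷ [] , _ , cong (λ v → a ∷ b ∷ v) (++-assoc w _ _)
    θw-factor : θ w IsFactorOf y
    θw-factor = a ∷ b ∷ w , _ , cong (λ v → a ∷ b ∷ v) (trans (++-assoc w _ _) (cong (w ++_) (++-assoc (θ w) _ _)))
    θ⁻¹w-factor : θ⁻¹ w IsFactorOf y
    θ⁻¹w-factor = a ∷ b ∷ w ++ θ w , _ , cong (λ v → a ∷ b ∷ v)
      (trans (++-assoc w _ _) (trans (cong (w ++_) (++-assoc (θ w) _ _)) (sym (++-assoc w (θ w) _))))

    y∤ : ∀ {b} → Star X b → ¬ y IsFactorOf b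
    y∤ b∈X* y∣b = w∤ b∈X* (factor-trans w-factor y∣b)

    open Completion X codeX y (λ ()) (padded-overlap-free a≢b (b ∷ t)) y∤

    added-factor : ∀ {z} → Added z → y IsFactorOf z
    added-factor (((s , z≡) , _) , _) = [] , s , z≡

    independent : Independent (graphOffFixedPoints θ) X → Independent (graphOffFixedPoints θ) Y
    independent indX z ((x , inj₁ x∈X , image) , inj₁ z∈X) = indX z ((x , x∈X , image) , z∈X)
    independent indX z ((x , inj₁ x∈X , refl , _) , inj₂ θx∈) = w∤ star-[ x∈X ]
      (subst₂ _IsFactorOf_ (θ⁻¹∘θ w) (θ⁻¹∘θ x) (θ⁻¹-factor (factor-trans θw-factor (added-factor θx∈))))
    independent indX z ((x , inj₂ x∈ , refl , _) , inj₁ θx∈X) = w∤ star-[ θx∈X ]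
      (subst (_IsFactorOf θ x) (θ∘θ⁻¹ w) (θ-factor (factor-trans θ⁻¹w-factor (added-factor x∈))))
    independent indX z ((x , inj₂ x∈ , refl , θx≢x) , inj₂ θx∈) with proj₂ (proj₂ (proj₂ moved-letters))
    ... | inj₁ θ≗id = θx≢x (θ≗id x)
    ... | inj₂ θy≢y = θy≢y t (length t)
      (flank-fixed (proj₂ (proj₁ (proj₁ x∈))) (proj₂ (proj₂ (proj₁ x∈))) (proj₂ (proj₁ (proj₁ θx∈))))

-- Reachability and automata

-- Warshall's algorithm: Via xs s t says that t is reached from s by a path
-- with all intermediate vertices in xs.
module Reachability {S : Set} (_≟_ : DecidableEquality S)
                    {E : S → S → Set} (E? : Decidable₂ E) where

  Via : List S → S → S → Set
  Via []       s t = s ≡ t ⊎ E s t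
  Via (x ∷ xs) s t = Via xs s t ⊎ (Via xs s x × Via xs x t)

  via? : ∀ xs → Decidable₂ (Via xs)
  via? []       s t = (s ≟ t) ⊎-dec E? s t
  via? (x ∷ xs) s t = via? xs s t ⊎-dec (via? xs s x ×-dec via? xs x t)

  via⇒reachable : ∀ xs {s t} → Via xs s t → RT.Star E s t
  via⇒reachable []       (inj₁ refl)    = ε
  via⇒reachable []       (inj₂ e)       = e ◅ ε
  via⇒reachable (x ∷ xs) (inj₁ p)       = via⇒reachable xs p
  via⇒reachable (x ∷ xs) (inj₂ (p , q)) = via⇒reachable xs p ◅◅ via⇒reachable xs q

  via-base : ∀ xs {s t} → s ≡ t ⊎ E s t → Via xs s t
  via-base []       p = p
  via-base (x ∷ xs) p = inj₁ (via-base xs p)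

  -- When both paths pass through the same `x`, the detour between the two visits is cut out, so
  -- that `x` is used only once.
  via-trans : ∀ {xs s t u} → u ∈ xs → Via xs s u → Via xs u t → Via xs s t
  via-trans (here refl)  p q = inj₂ ([ id , proj₁ ]′ p , [ id , proj₂ ]′ q)
  via-trans (there u∈xs) (inj₁ p)        (inj₁ q)        = inj₁ (via-trans u∈xs p q)
  via-trans (there u∈xs) (inj₁ p)        (inj₂ (q , q′)) = inj₂ (via-trans u∈xs p q , q′)
  via-trans (there u∈xs) (inj₂ (p , p′)) (inj₁ q)        = inj₂ (p , via-trans u∈xs p′ q)
  via-trans (there u∈xs) (inj₂ (p , _))  (inj₂ (_ , q′)) = inj₂ (p , q′)

  reachable? : ∀ xs → (∀ s → s ∈ xs) → Decidable₂ (RT.Star E)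
  reachable? xs all∈ s t = map′ (via⇒reachable xs) complete (via? xs s t)
    where
    complete : ∀ {s} → RT.Star E s t → Via xs s t
    complete ε              = via-base xs (inj₁ refl)
    complete (_◅_ {j = u} e p) = via-trans (all∈ u) (via-base xs (inj₂ e)) (complete p)

module Runs {k : ℕ} {S : Set} (Step : S → Fin k → S → Set) where

  Run : S → Word k → S → Set
  Run p []      q = p ≡ q
  Run p (a ∷ w) q = ∃ λ r → Step p a r × Run r w q

  run-++⁺ : ∀ {p q r} u {v} → Run p u q → Run q v r → Run p (u ++ v) r
  run-++⁺ []      refl            run′ = run′
  run-++⁺ (a ∷ u) (s , step , run) run′ = s , step , run-++⁺ u run run′

  run-++⁻ : ∀ {p r} u {v} → Run p (u ++ v) r → ∃ λ q → Run p u q × Run q v r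
  run-++⁻ []      run              = _ , refl , run
  run-++⁻ (a ∷ u) (s , step , run) = let q , run₁ , run₂ = run-++⁻ u run in q , (s , step , run₁) , run₂

  Edge : S → S → Set
  Edge p q = ∃ λ a → Step p a q

  run⇒reachable : ∀ {p q} w → Run p w q → RT.Star Edge p q
  run⇒reachable []      refl             = ε
  run⇒reachable (a ∷ w) (r , step , run) = (a , step) ◅ run⇒reachable w run

  reachable⇒run : ∀ {p q} → RT.Star Edge p q → ∃ λ w → Run p w q
  reachable⇒run ε                 = [] , refl
  reachable⇒run ((a , step) ◅ ps) = let w , run = reachable⇒run ps in a ∷ w , _ , step , run

comprehension : ∀ {n} {P : Fin n → Set} → Decidable P → Subset n
comprehension P? = Vec.tabulate (does ∘ P?)

∈-comprehension⁺ : ∀ {n} {P : Fin n → Set} (P? : Decidable P) {q} → P q → q Subset.∈ comprehension P?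
∈-comprehension⁺ P? {q} Pq = Vec.lookup⇒[]= q _ (trans (Vec.lookup∘tabulate (does ∘ P?) q) (dec-true (P? q) Pq))

∈-comprehension⁻ : ∀ {n} {P : Fin n → Set} (P? : Decidable P) {q} → q Subset.∈ comprehension P? → P q
∈-comprehension⁻ P? {q} q∈ with P? q | trans (sym (Vec.lookup∘tabulate (does ∘ P?) q)) (Vec.[]=⇒lookup q∈)
... | yes Pq | _ = Pq

allSubsets : ∀ n → List (Subset n)
allSubsets zero    = Vec.[] ∷ []
allSubsets (suc n) = cartesianProductWith Vec._∷_ (inside ∷ outside ∷ []) (allSubsets n)

∈-allSubsets : ∀ {n} (T : Subset n) → T ∈ allSubsets n
∈-allSubsets Vec.[]      = here refl
∈-allSubsets (b Vec.∷ T) = ∈-cartesianProductWith⁺ Vec._∷_ (b∈ b) (∈-allSubsets T)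
  where
  b∈ : ∀ b → b ∈ inside ∷ outside ∷ []
  b∈ inside  = here refl
  b∈ outside = there (here refl)

module _ {k : ℕ} (M : Automaton k) where
  open Automaton M

  acceptedFrom? : ∀ q → Decidable (AcceptedFrom M q)
  acceptedFrom? q []      = q ∈? final
  acceptedFrom? q (a ∷ w) = Fin.any? λ q′ → (q′ ∈? next q a) ×-dec acceptedFrom? q′ w

  accepted? : Decidable (Accepted M)
  accepted? w = Fin.any? λ q → (q ∈? initial) ×-dec acceptedFrom? q w

-- An automaton for X⁺: in a final state, the machine may also read its next
-- letter from an initial state.
module StarAutomaton {k : ℕ} (M : Automaton k) ([]∉ : ¬ Accepted M []) where
  open Automaton M

  X : Language k
  X = Accepted M

  Step : Fin size → Fin k → Fin size → Set
  Step p a r = r Subset.∈ next p a ⊎ (p Subset.∈ final × ∃ λ i → i Subset.∈ initial × r Subset.∈ next i a)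

  step? : ∀ p a r → Dec (Step p a r)
  step? p a r = (r ∈? next p a) ⊎-dec ((p ∈? final) ×-dec Fin.any? λ i → (i ∈? initial) ×-dec (r ∈? next i a))

  open Runs Step

  reachable? : Decidable₂ (RT.Star Edge)
  reachable? = Reachability.reachable? Fin._≟_ (λ p q → Fin.any? λ a → step? p a q) (allFin size) ∈-allFin

  Entry Exit : Fin size → Set
  Entry p = ∃ λ i → i Subset.∈ initial × RT.Star Edge i p
  Exit q  = ∃ λ f → f Subset.∈ final × RT.Star Edge q f

  entry? : Decidable Entry
  entry? p = Fin.any? λ i → (i ∈? initial) ×-dec reachable? i p

  exit? : Decidable Exit
  exit? q = Fin.any? λ f → (f ∈? final) ×-dec reachable? q f

  -- The run is cut at its first restart: `u` completes the word being read, and `v` is what is read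
  -- afterwards.
  run⇒star : ∀ {p f} w → Run p w f → f Subset.∈ final →
             ∃₂ λ u v → w ≡ u ++ v × AcceptedFrom M p u × Star X v
  run⇒star []      refl             f∈F = [] , [] , refl , f∈F , [] , [] , refl
  run⇒star (a ∷ w) (r , step , run) f∈F with run⇒star w run f∈F
  run⇒star (a ∷ w) (r , inj₁ r∈ , run) f∈F | u , v , refl , u-acc , v∈X* =
    a ∷ u , v , refl , (r , r∈ , u-acc) , v∈X*
  run⇒star (a ∷ w) (r , inj₂ (p∈F , i , i∈I , r∈) , run) f∈F | u , v , refl , u-acc , v∈X* =
    [] , a ∷ u ++ v , refl , p∈F , star-++ {u = a ∷ u} star-[ i , i∈I , r , r∈ , u-acc ] v∈X*

  initial-run⇒star : ∀ {i f} w → i Subset.∈ initial → Run i w f → f Subset.∈ final → Star X w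
  initial-run⇒star w i∈I run f∈F with run⇒star w run f∈F
  ... | u , v , refl , u-acc , v∈X* = star-++ star-[ _ , i∈I , u-acc ] v∈X*

  -- Generalized to a factor already partly read, with `u` its unread rest. An empty factor would
  -- offer no letter on which to restart.
  accepted⇒run : ∀ xs u {p} → All X xs → AcceptedFrom M p u →
                 ∃ λ f → f Subset.∈ final × Run p (u ++ concat xs) f
  accepted⇒run []             []      []         p∈F = _ , p∈F , refl
  accepted⇒run ([] ∷ xs)      []      (x∈ ∷ _)   _   = ⊥-elim ([]∉ x∈)
  accepted⇒run ((a ∷ x) ∷ xs) []      ((i , i∈I , r , r∈ , x-acc) ∷ xs∈) p∈F =
    let f , f∈F , run = accepted⇒run xs x xs∈ x-acc in
    f , f∈F , r , inj₂ (p∈F , i , i∈I , r∈) , run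
  accepted⇒run xs             (a ∷ u) xs∈        (r , r∈ , u-acc) =
    let f , f∈F , run = accepted⇒run xs u xs∈ u-acc in
    f , f∈F , r , inj₁ r∈ , run

  star⇒run : ∀ {w} → Star X w → w ≢ [] → ∃₂ λ i f → i Subset.∈ initial × f Subset.∈ final × Run i w f
  star⇒run ([]     , []                      , refl) w≢[] = ⊥-elim (w≢[] refl)
  star⇒run (x ∷ xs , (i , i∈I , x-acc) ∷ xs∈ , refl) _    =
    let f , f∈F , run = accepted⇒run xs x xs∈ x-acc in i , f , i∈I , f∈F , run

  factor⇒run : ∀ {w y} → w ≢ [] → Star X y → w IsFactorOf y →
               ∃₂ λ p q → Entry p × Run p w q × Exit q
  factor⇒run {w} w≢[] y∈X* (u , v , refl)
    with star⇒run y∈X* (λ eq → w≢[] (++-conicalˡ w v (++-conicalʳ u (w ++ v) eq)))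
  ... | i , f , i∈I , f∈F , run =
    let p , run₁ , run′ = run-++⁻ u run
        q , run₂ , run₃ = run-++⁻ w run′
    in p , q , (i , i∈I , run⇒reachable u run₁) , run₂ , (f , f∈F , run⇒reachable v run₃)

  -- One fixed word per state, so that finitely many contexts suffice. The value `[]` is a
  -- placeholder for states without such a path.
  entryWord exitWord : Fin size → Word k
  entryWord p with entry? p
  ... | yes (_ , _ , path) = proj₁ (reachable⇒run path)
  ... | no  _              = []
  exitWord q with exit? q
  ... | yes (_ , _ , path) = proj₁ (reachable⇒run path)
  ... | no  _              = []

  entry-run : ∀ {p} → Entry p → ∃ λ i → i Subset.∈ initial × Run i (entryWord p) p
  entry-run {p} entry with entry? p
  ... | yes (i , i∈I , path) = i , i∈I , proj₂ (reachable⇒run path)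
  ... | no  ¬entry           = ⊥-elim (¬entry entry)

  exit-run : ∀ {q} → Exit q → ∃ λ f → f Subset.∈ final × Run q (exitWord q) f
  exit-run {q} exit with exit? q
  ... | yes (f , f∈F , path) = f , f∈F , proj₂ (reachable⇒run path)
  ... | no  ¬exit            = ⊥-elim (¬exit exit)

  run⇒context : ∀ {p q} w → Entry p → Run p w q → Exit q → Star X (entryWord p ++ w ++ exitWord q)
  run⇒context {p} w entry run exit =
    let i , i∈I , run₁ = entry-run entry
        f , f∈F , run₃ = exit-run exit
    in initial-run⇒star _ i∈I (run-++⁺ (entryWord p) run₁ (run-++⁺ w run run₃)) f∈F

  -- The pair of empty words serves the empty word, for which a product over `X` may come with no
  -- run.
  contexts : List (Word k × Word k)
  contexts = ([] , []) ∷ cartesianProduct (map entryWord (allFin size)) (map exitWord (allFin size))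

  -- Only the states before and after `w` matter, so the actual surroundings are exchanged for the
  -- fixed words of those two states.
  factor⇒context : ∀ w {y} → Star X y → w IsFactorOf y →
                   ∃ λ c → c ∈ contexts × Star X (proj₁ c ++ w ++ proj₂ c)
  factor⇒context []         _    _ = ([] , []) , here refl , [] , [] , refl
  factor⇒context w@(_ ∷ _) y∈X* w∣y =
    let p , q , entry , run , exit = factor⇒run (λ ()) y∈X* w∣y in
    (entryWord p , exitWord q) ,
    there (∈-cartesianProduct⁺ (∈-map⁺ entryWord (∈-allFin p)) (∈-map⁺ exitWord (∈-allFin q))) ,
    run⇒context w entry run exit

  -- Subset construction and the decision of completeness

  Successor : Subset size → Fin k → Fin size → Set
  Successor T a q = ∃ λ p → p Subset.∈ T × Step p a q

  successor? : ∀ T a → Decidable (Successor T a)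
  successor? T a q = Fin.any? λ p → (p ∈? T) ×-dec step? p a q

  successors : Subset size → Fin k → Subset size
  successors T a = comprehension (successor? T a)

  SubsetEdge : Subset size → Subset size → Set
  SubsetEdge T T′ = ∃ λ a → T′ ≡ successors T a

  subset-reachable? : Decidable₂ (RT.Star SubsetEdge)
  subset-reachable? = Reachability.reachable? _≟_ (λ T T′ → Fin.any? λ a → T′ ≟ successors T a)
                        (allSubsets size) ∈-allSubsets
    where
    _≟_ : DecidableEquality (Subset size)
    _≟_ = Vec.≡-dec Bool._≟_

  successors* : Subset size → Word k → Subset size
  successors* = foldl successors

  ∈-successors*⁺ : ∀ w {T p q} → p Subset.∈ T → Run p w q → q Subset.∈ successors* T w
  ∈-successors*⁺ []      p∈T refl             = p∈T
  ∈-successors*⁺ (a ∷ w) p∈T (r , step , run) =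
    ∈-successors*⁺ w (∈-comprehension⁺ (successor? _ a) (_ , p∈T , step)) run

  ∈-successors*⁻ : ∀ w {T q} → q Subset.∈ successors* T w → ∃ λ p → p Subset.∈ T × Run p w q
  ∈-successors*⁻ []      q∈T = _ , q∈T , refl
  ∈-successors*⁻ (a ∷ w) q∈  =
    let r , r∈ , run     = ∈-successors*⁻ w q∈
        p , p∈T , step   = ∈-comprehension⁻ (successor? _ a) r∈
    in p , p∈T , r , step , run

  reachable⇒successors* : ∀ {T T′} → RT.Star SubsetEdge T T′ → ∃ λ w → T′ ≡ successors* T w
  reachable⇒successors* ε                 = [] , refl
  reachable⇒successors* ((a , refl) ◅ ps) = let w , eq = reachable⇒successors* ps in a ∷ w , eq

  successors*⇒reachable : ∀ w {T} → RT.Star SubsetEdge T (successors* T w)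
  successors*⇒reachable []      = ε
  successors*⇒reachable (a ∷ w) = (a , refl) ◅ successors*⇒reachable w

  entries : Subset size
  entries = comprehension entry?

  Live : Subset size → Set
  Live T = ∃ λ q → q Subset.∈ T × Exit q

  live? : Decidable Live
  live? T = Fin.any? λ q → (q ∈? T) ×-dec exit? q

  live⇒factor : ∀ w → Live (successors* entries w) → ∃ λ y → Star X y × w IsFactorOf y
  live⇒factor w (q , q∈ , exit) =
    let p , p∈ , run = ∈-successors*⁻ w q∈
    in _ , run⇒context w (∈-comprehension⁻ entry? p∈) run exit , entryWord p , exitWord q , refl

  factor⇒live : ∀ {w y} → w ≢ [] → Star X y → w IsFactorOf y → Live (successors* entries w)
  factor⇒live {w} w≢[] y∈X* w∣y =
    let p , q , entry , run , exit = factor⇒run w≢[] y∈X* w∣y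
    in q , ∈-successors*⁺ w (∈-comprehension⁺ entry? entry) run , exit

  -- A nonempty word is a factor of `X*` exactly when the subset it reaches from `entries` is live,
  -- so a gap is a dead subset reached by at least one letter. Hence the separate first letter `a`.
  complete-or-gap : Complete X ⊎ ∃ λ w → ∀ {y} → Star X y → ¬ w IsFactorOf y
  complete-or-gap with Fin.any? (λ a → anySubset? λ T → subset-reachable? (successors entries a) T ×-dec ¬? (live? T))
  ... | yes (a , T , path , dead) with reachable⇒successors* path
  ...   | w , refl = inj₂ (a ∷ w , λ y∈X* aw∣y → dead (factor⇒live {a ∷ w} (λ ()) y∈X* aw∣y))
  complete-or-gap | no ¬dead = inj₁ λ
    { []      → [] , ([] , [] , refl) , [] , [] , refl
    ; (a ∷ w) → case live? (successors* entries (a ∷ w)) of λ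
        { (yes live) → live⇒factor (a ∷ w) live
        ; (no dead)  → ⊥-elim (¬dead (a , _ , successors*⇒reachable w , dead)) } }

exists? : ∀ {P : A → Set} (xs : List A) → (∀ x → x ∈ xs) → Decidable P → Dec (∃ P)
exists? xs all∈ P? = map′ Any.satisfied (λ { (x , Px) → lose (all∈ x) Px }) (Any.any? P? xs)

-- Peeling the first and last letters a, b off a word peels the letters L a b
-- and R a b off its image, so a word w ∈ X with θ w ∈ X and θ w ≢ w is found by
-- following both runs from the two ends at once.  A state consists of the four
-- ends of the unread parts and a flag telling whether those parts still have
-- to witness θ w ≢ w.
module Bilateral {k : ℕ} (M : Automaton k) (θ : Word k → Word k)
                 (L R : Fin k → Fin k → Fin k) (σ : Fin k → Fin k)
                 (θ-[] : θ [] ≡ []) (θ-[_] : ∀ c → θ (c ∷ []) ≡ σ c ∷ [])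
                 (θ-ends : ∀ a m b → θ (a ∷ m ++ b ∷ []) ≡ L a b ∷ θ m ++ R a b ∷ []) where
  open Automaton M

  Step : Fin size → Fin k → Fin size → Set
  Step p a q = q Subset.∈ next p a

  open Runs Step

  accepted⇒run : ∀ {p} w → AcceptedFrom M p w → ∃ λ f → f Subset.∈ final × Run p w f
  accepted⇒run []      p∈F            = _ , p∈F , refl
  accepted⇒run (a ∷ w) (r , r∈ , w-acc) = let f , f∈F , run = accepted⇒run w w-acc in f , f∈F , r , r∈ , run

  run⇒accepted : ∀ {p f} w → f Subset.∈ final → Run p w f → AcceptedFrom M p w
  run⇒accepted []      f∈F refl           = f∈F
  run⇒accepted (a ∷ w) f∈F (r , r∈ , run) = r , r∈ , run⇒accepted w f∈F run

  State : Set
  State = ((Fin size × Fin size) × (Fin size × Fin size)) × Bool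

  states : List State
  states = cartesianProduct (cartesianProduct pairs pairs) (true ∷ false ∷ [])
    where pairs = cartesianProduct (allFin size) (allFin size)

  ∈-states : ∀ s → s ∈ states
  ∈-states (((p , q) , (p′ , q′)) , f) =
    ∈-cartesianProduct⁺ (∈-cartesianProduct⁺ (pair∈ p q) (pair∈ p′ q′)) (bool∈ f)
    where
    pair∈ : ∀ p q → (p , q) ∈ cartesianProduct (allFin size) (allFin size)
    pair∈ p q = ∈-cartesianProduct⁺ (∈-allFin p) (∈-allFin q)
    bool∈ : ∀ f → f ∈ true ∷ false ∷ []
    bool∈ true  = here refl
    bool∈ false = there (here refl)

  _≟ˢ_ : DecidableEquality State
  _≟ˢ_ = Product.≡-dec (Product.≡-dec pair≟ pair≟) Bool._≟_
    where pair≟ = Product.≡-dec Fin._≟_ Fin._≟_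

  Reads : State → Word k → Set
  Reads (((p , q) , (p′ , q′)) , f) m = Run p m q × Run p′ (θ m) q′ × (f ≡ true → θ m ≢ m)

  -- A mismatch at the two ends frees the new flag; without one the obligation is handed to the
  -- middle unchanged.
  Peel : State → State → Fin k → Fin k → Set
  Peel (((p , q) , (p′ , q′)) , f) (((r , s) , (r′ , s′)) , g) a b =
    (Step p a r × Step s b q) × (Step p′ (L a b) r′ × Step s′ (R a b) q′) ×
    (g ≡ f ⊎ (L a b ≢ a ⊎ R a b ≢ b))

  PeelEdge : State → State → Set
  PeelEdge s t = ∃₂ λ a b → Peel s t a b

  peelEdge? : Decidable₂ PeelEdge
  peelEdge? (((p , q) , (p′ , q′)) , f) (((r , s) , (r′ , s′)) , g) = Fin.any? λ a → Fin.any? λ b →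
    ((r ∈? next p a) ×-dec (q ∈? next s b)) ×-dec ((r′ ∈? next p′ (L a b)) ×-dec (q′ ∈? next s′ (R a b))) ×-dec
    ((g Bool.≟ f) ⊎-dec (¬? (L a b Fin.≟ a) ⊎-dec ¬? (R a b Fin.≟ b)))

  -- At most one letter is left. With none left the flag must be down, since `θ` fixes the empty
  -- word.
  Terminal : State → Set
  Terminal (((p , q) , (p′ , q′)) , f) =
    ((p ≡ q × p′ ≡ q′) × f ≡ false) ⊎
    (∃ λ c → (Step p c q × Step p′ (σ c) q′) × (f ≡ false ⊎ σ c ≢ c))

  terminal? : Decidable Terminal
  terminal? (((p , q) , (p′ , q′)) , f) =
    (((p Fin.≟ q) ×-dec (p′ Fin.≟ q′)) ×-dec (f Bool.≟ false)) ⊎-dec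
    (Fin.any? λ c → ((q ∈? next p c) ×-dec (q′ ∈? next p′ (σ c))) ×-dec ((f Bool.≟ false) ⊎-dec ¬? (σ c Fin.≟ c)))

  terminal⇒reads : ∀ {t} → Terminal t → ∃ (Reads t)
  terminal⇒reads {((p , q) , (p′ , q′)) , f} (inj₁ ((refl , refl) , refl)) =
    [] , refl , subst (λ w → Run p′ w p′) (sym θ-[]) refl , λ ()
  terminal⇒reads {((p , q) , (p′ , q′)) , f} (inj₂ (c , (c∈ , c′∈) , mismatch)) =
    c ∷ [] , (q , c∈ , refl) , subst (λ w → Run p′ w q′) (sym θ-[ c ]) (q′ , c′∈ , refl) ,
    λ f≡true θc≡c → [ (λ f≡false → case trans (sym f≡true) f≡false of λ ())
                    , (λ σc≢c → σc≢c (∷-injectiveˡ (trans (sym θ-[ c ]) θc≡c))) ]′ mismatch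

  ends-injective : ∀ {a b c d : Fin k} u v → a ∷ u ++ b ∷ [] ≡ c ∷ v ++ d ∷ [] → a ≡ c × u ≡ v × b ≡ d
  ends-injective u v eq = let u≡v , b≡d = ∷ʳ-injective u v (∷-injectiveʳ eq) in ∷-injectiveˡ eq , u≡v , b≡d

  path⇒reads : ∀ {s t} → RT.Star PeelEdge s t → Terminal t → ∃ (Reads s)
  path⇒reads ε term = terminal⇒reads term
  path⇒reads {((p , q) , (p′ , q′)) , f}
             (_◅_ {j = ((r , s) , (r′ , s′)) , g} (a , b , (a∈ , b∈) , (a′∈ , b′∈) , flags) path) term
    with path⇒reads path term
  ... | m , run , run′ , differs =
    a ∷ m ++ b ∷ [] , (r , a∈ , run-++⁺ m run (q , b∈ , refl)) ,
    subst (λ w → Run p′ w q′) (sym (θ-ends a m b)) (r′ , a′∈ , run-++⁺ (θ m) run′ (q′ , b′∈ , refl)) ,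
    λ f≡true fixed → case ends-injective (θ m) m (trans (sym (θ-ends a m b)) fixed) of λ
      { (La≡a , θm≡m , Rb≡b) → case flags of λ
          { (inj₁ g≡f)           → differs (trans g≡f f≡true) θm≡m
          ; (inj₂ (inj₁ La≢a))   → La≢a La≡a
          ; (inj₂ (inj₂ Rb≢b))   → Rb≢b Rb≡b } }

  reads⇒path : ∀ m {s} → Acc ℕ._<_ (length m) → Reads s m → ∃ λ t → RT.Star PeelEdge s t × Terminal t
  reads⇒path [] {((p , q) , (p′ , q′)) , true} _ (run , run′ , differs) = ⊥-elim (differs refl θ-[])
  reads⇒path [] {((p , q) , (p′ , q′)) , false} _ (run , run′ , differs) =
    _ , ε , inj₁ ((run , subst (λ w → Run p′ w q′) θ-[] run′) , refl)
  reads⇒path (a ∷ m) _ _ with initLast m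
  reads⇒path (c ∷ .[]) {((p , q) , (p′ , q′)) , f} _ ((_ , c∈ , refl) , run′ , differs) | []
    with subst (λ w → Run p′ w q′) θ-[ c ] run′
  ... | _ , c′∈ , refl = _ , ε , inj₂ (c , (c∈ , c′∈) , flag f differs)
    where
    flag : ∀ f → (f ≡ true → θ (c ∷ []) ≢ c ∷ []) → f ≡ false ⊎ σ c ≢ c
    flag false _       = inj₁ refl
    flag true  differs = inj₂ λ σc≡c → differs refl (trans θ-[ c ] (cong (_∷ []) σc≡c))
  reads⇒path (a ∷ .(m ∷ʳ b)) {((p , q) , (p′ , q′)) , f} (acc rec) ((r , a∈ , run) , run′ , differs) | m ∷ʳ′ b
    with run-++⁻ m run | subst (λ w → Run p′ w q′) (θ-ends a m b) run′
  ... | s , run-m , (_ , b∈ , refl) | r′ , a′∈ , run₁ with run-++⁻ (θ m) run₁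
  ... | s′ , run′-m , (_ , b′∈ , refl) = peel (L a b Fin.≟ a) (R a b Fin.≟ b)
    where
    shorter : length m ℕ.< length (a ∷ m ∷ʳ b)
    shorter = ℕ.s≤s (length-≤-++ˡ m (b ∷ []))
    peel : Dec (L a b ≡ a) → Dec (R a b ≡ b) →
           ∃ λ t → RT.Star PeelEdge (((p , q) , (p′ , q′)) , f) t × Terminal t
    peel (yes La≡a) (yes Rb≡b) with reads⇒path m {((r , s) , (r′ , s′)) , f} (rec shorter)
      (run-m , run′-m , λ f≡true θm≡m → differs f≡true
        (trans (θ-ends a m b) (cong₂ _∷_ La≡a (cong₂ (λ u c → u ++ c ∷ []) θm≡m Rb≡b))))
    ... | t , path , term = t , (a , b , (a∈ , b∈) , (a′∈ , b′∈) , inj₁ refl) ◅ path , term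
    -- The outer letters already witness the difference, so the flag is lowered: the middle may be
    -- fixed by `θ`.
    peel (no La≢a) _ with reads⇒path m {((r , s) , (r′ , s′)) , false} (rec shorter) (run-m , run′-m , λ ())
    ... | t , path , term = t , (a , b , (a∈ , b∈) , (a′∈ , b′∈) , inj₂ (inj₁ La≢a)) ◅ path , term
    peel _ (no Rb≢b) with reads⇒path m {((r , s) , (r′ , s′)) , false} (rec shorter) (run-m , run′-m , λ ())
    ... | t , path , term = t , (a , b , (a∈ , b∈) , (a′∈ , b′∈) , inj₂ (inj₂ Rb≢b)) ◅ path , term

  dependent? : Dec (∃ λ w → Accepted M w × Accepted M (θ w) × θ w ≢ w)
  dependent? = map′ to from
    (Fin.any? λ i → Fin.any? λ f → Fin.any? λ i′ → Fin.any? λ f′ →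
      (((i ∈? initial) ×-dec (f ∈? final)) ×-dec ((i′ ∈? initial) ×-dec (f′ ∈? final))) ×-dec
      exists? states ∈-states λ t →
        Reachability.reachable? _≟ˢ_ peelEdge? states ∈-states (((i , f) , (i′ , f′)) , true) t ×-dec terminal? t)
    where
    Found : Set
    Found = ∃ λ i → ∃ λ f → ∃ λ i′ → ∃ λ f′ →
      ((i Subset.∈ initial × f Subset.∈ final) × (i′ Subset.∈ initial × f′ Subset.∈ final)) ×
      ∃ λ t → RT.Star PeelEdge (((i , f) , (i′ , f′)) , true) t × Terminal t
    to : Found → ∃ λ w → Accepted M w × Accepted M (θ w) × θ w ≢ w
    to (i , f , i′ , f′ , ((i∈ , f∈) , (i′∈ , f′∈)) , t , path , term) =
      let w , run , run′ , differs = path⇒reads path term in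
      w , (i , i∈ , run⇒accepted w f∈ run) , (i′ , i′∈ , run⇒accepted (θ w) f′∈ run′) , differs refl
    from : (∃ λ w → Accepted M w × Accepted M (θ w) × θ w ≢ w) → Found
    from (w , (i , i∈ , w-acc) , (i′ , i′∈ , θw-acc) , θw≢w) =
      let f , f∈ , run = accepted⇒run w w-acc
          f′ , f′∈ , run′ = accepted⇒run (θ w) θw-acc
      in i , f , i′ , f′ , ((i∈ , f∈) , (i′∈ , f′∈)) , reads⇒path w (<-wellFounded _) (run , run′ , λ _ → θw≢w)

dependent? : ∀ {k} (M : Automaton k) {θ : Word k → Word k} → Symmetry θ →
             Dec (∃ λ w → Accepted M w × Accepted M (θ w) × θ w ≢ w)
dependent? {k} M {θ} S with Symmetry.shape S
... | inj₁ θ≗ = Bilateral.dependent? M θ (λ a b → σ a) (λ a b → σ b) σ (θ≗ []) (λ c → θ≗ (c ∷ []))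
  (λ a m b → trans (θ≗ _) (cong (σ a ∷_) (trans (map-++ σ m (b ∷ [])) (cong (_++ σ b ∷ []) (sym (θ≗ m))))))
  where open Symmetry S using (σ)
-- Reversal exchanges the ends: the last letter of the word determines the first letter of its
-- image.
... | inj₂ θ≗ = Bilateral.dependent? M θ (λ a b → σ b) (λ a b → σ a) σ (θ≗ []) (λ c → θ≗ (c ∷ [])) ends
  where
  open Symmetry S using (σ)
  ends : ∀ a m b → θ (a ∷ m ++ b ∷ []) ≡ σ b ∷ θ m ++ σ a ∷ []
  ends a m b = begin
    θ (a ∷ m ++ b ∷ [])                                  ≡⟨ θ≗ _ ⟩
    reverse (σ a ∷ map σ (m ++ b ∷ []))                  ≡⟨ unfold-reverse (σ a) (map σ (m ++ b ∷ [])) ⟩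
    reverse (map σ (m ++ b ∷ [])) ++ σ a ∷ []
      ≡⟨ cong (λ v → reverse v ++ σ a ∷ []) (map-++ σ m (b ∷ [])) ⟩
    reverse (map σ m ++ σ b ∷ []) ++ σ a ∷ []
      ≡⟨ cong (_++ σ a ∷ []) (reverse-++ (map σ m) (σ b ∷ [])) ⟩
    σ b ∷ reverse (map σ m) ++ σ a ∷ []                  ≡⟨ cong (λ v → σ b ∷ v ++ σ a ∷ []) (θ≗ m) ⟨
    σ b ∷ θ m ++ σ a ∷ []                                ∎
    where open ≡-Reasoning

-- Maximality, completeness and measure for a regular code

module RegularCode {k : ℕ} .{{_ : NonTrivial k}} (X : Language k) (M : Automaton k)
                   (X≐M : X ≐ Accepted M) (codeX : IsCode X) where

  X? : Decidable X
  X? w = map′ (proj₂ X≐M) (proj₁ X≐M) (accepted? M w)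

  -- The empty word would equal its own square, giving factorizations with one and with two factors.
  []∉X : ¬ X []
  []∉X []∈X = case codeX ([] ∷ []) ([] ∷ [] ∷ []) ([]∈X ∷ []) ([]∈X ∷ []∈X ∷ []) refl of λ ()

  open StarAutomaton M ([]∉X ∘ proj₂ X≐M)
    renaming (complete-or-gap to accepted-complete-or-gap) using (contexts; factor⇒context)

  complete-or-gap : Complete X ⊎ ∃ λ w → ∀ {y} → Star X y → ¬ w IsFactorOf y
  complete-or-gap with accepted-complete-or-gap
  ... | inj₁ complete  = inj₁ λ w → let y , y∈ , w∣y = complete w in y , star-⊆ (proj₂ X≐M) y∈ , w∣y
  ... | inj₂ (w , gap) = inj₂ (w , λ y∈ → gap (star-⊆ (proj₁ X≐M) y∈))

  complete⇒measure-one : Complete X → HasMeasure X 1ℚ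
  complete⇒measure-one complete = (λ ws → kraft codeX) ,
    finite-contexts⇒dense X? []∉X contexts λ w →
      let y , y∈ , w∣y = complete w
          c , c∈ , filled = factor⇒context w (star-⊆ (proj₁ X≐M) y∈) w∣y
      in c , c∈ , star-⊆ (proj₂ X≐M) filled

  complete⇒code-maximal : Complete X → ∀ {Y : Language k} → IsCode Y → X ⊆ Y → Y ⊆ X
  complete⇒code-maximal complete codeY X⊆Y y∈Y =
    decidable-stable (X? _) (measure-one-code-maximal (complete⇒measure-one complete) codeY X⊆Y y∈Y)

  module _ {θ : Word k → Word k} (S : Symmetry θ) where

    private
      τ = graphOffFixedPoints θ
    open SymmetryProperties S

    complete-or-completion : Complete X ⊎ CodeCompletion X
    complete-or-completion with complete-or-gap
    ... | inj₁ complete  = inj₁ complete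
    ... | inj₂ (w , gap) = inj₂ (complete-code codeX X? w gap)

    -- An incomplete `X` has a strictly larger code as its completion, and measure one leaves no
    -- weight for a further word.
    measure-one⇒complete : HasMeasure X 1ℚ → Complete X
    measure-one⇒complete μX≡1 with complete-or-completion
    ... | inj₁ complete = complete
    ... | inj₂ C        = let y , y∈Y , y∉X = new in
                          ⊥-elim (measure-one-code-maximal μX≡1 code X⊆Y y∈Y y∉X)
      where open CodeCompletion C

    maximal⇒complete : MaximalIn (IndependentCode τ) X → Complete X
    maximal⇒complete ((_ , indX) , maximalX) with complete-or-completion
    ... | inj₁ complete = complete
    ... | inj₂ C        = let y , y∈Y , y∉X = new in
                          ⊥-elim (y∉X (proj₁ (maximalX Y (code , independent indX) X⊆Y) y∈Y))
      where open CodeCompletion C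

    complete⇒maximal : Independent τ X → Complete X → MaximalIn (IndependentCode τ) X
    complete⇒maximal indX complete = (codeX , indX) ,
      λ Y (codeY , _) X⊆Y → complete⇒code-maximal complete codeY X⊆Y , X⊆Y

    independent? : Dec (Independent τ X)
    independent? = map′
      (λ none z → λ { ((x , x∈X , refl , θx≢x) , θx∈X) → none (x , proj₁ X≐M x∈X , proj₁ X≐M θx∈X , θx≢x) })
      (λ indX → λ { (x , x∈ , θx∈ , θx≢x) → indX (θ x) ((x , proj₂ X≐M x∈ , refl , θx≢x) , proj₂ X≐M θx∈) })
      (¬? (dependent? M S))

    maximal? : Dec (MaximalIn (IndependentCode τ) X)
    maximal? with independent? | complete-or-gap
    ... | no  ¬indX | _              = no λ maximalX → ¬indX (proj₂ (proj₁ maximalX))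
    ... | yes indX  | inj₁ complete  = yes (complete⇒maximal indX complete)
    ... | yes _     | inj₂ (w , gap) = no λ maximalX →
      let y , y∈ , w∣y = maximal⇒complete maximalX w in gap y∈ w∣y

    embedding : Independent τ X → ∃ λ Y → X ⊆ Y × MaximalIn (IndependentCode τ) Y
    embedding indX with complete-or-completion
    ... | inj₁ complete = X , id , complete⇒maximal indX complete
    ... | inj₂ C        = Y , X⊆Y , (code , independent indX) , λ Z (codeZ , _) Y⊆Z → maximal codeZ Y⊆Z , Y⊆Z
      where open CodeCompletion C

-- Completeness does not force independence: the set of letters is a complete code, but a nontrivial
-- letter permutation sends some letter to another. Hence independence is assumed when maximality is
-- deduced from completeness.
proposition6p9 : ∀ (k : ℕ) .{{_ : NonTrivial k}}
    (θ : Word k → Word k) → IsAutomorphism θ ⊎ IsAntiAutomorphism θ →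
    ∀ (X : Language k) (M : Automaton k) → X ≐ Accepted M → IsCode X →
    let τ = graphOffFixedPoints θ
        MaximalIndependentCode = MaximalIn (IndependentCode τ)
    in
    ( (MaximalIndependentCode X → Complete X)
    × (Independent τ X → Complete X → MaximalIndependentCode X)
    × (Complete X ⇔ HasMeasure X 1ℚ) )
    × Dec (MaximalIndependentCode X)
    × (Independent τ X → ∃ λ Y → X ⊆ Y × MaximalIndependentCode Y)
proposition6p9 k θ θ-symmetry X M X≐M codeX =
  (maximal⇒complete S , complete⇒maximal S , mk⇔ complete⇒measure-one (measure-one⇒complete S)) ,
  maximal? S , embedding S
  where
  open RegularCode X M X≐M codeX
  S = symmetry θ θ-symmetry
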